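{- A hereditary family of graphs has the Erdős–Hajnal property if and only if it has the polynomial Rödl property.
   Context: A family of finite graphs is hereditary if it is closed under taking induced subgraphs. $\hom(G)$ is the size of a largest clique or independent set of $G$. A family $\mathcal{F}$ has the Erdős–Hajnal property if there is $c>0$ such that every $G\in\mathcal{F}$ on $n$ vertices has $\hom(G)\ge n^{c}$. A vertex set $S$ is $\varepsilon$-homogeneous if the edge density of $G[S]$ is at most $\varepsilon$ or at least $1-\varepsilon$. $\mathcal{F}$ has the polynomial Rödl property if there is $C$ such that for every $0<\varepsilon<1/2$, every $G\in\mathcal{F}$ on $n$ vertices has an $\varepsilon$-homogeneous set $S$ with $|S|\ge\varepsilon^{C}n$. -}

module Defs where

open import Data.Nat as ℕ using (ℕ; zero; suc; _⊔_; _≤_)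
open import Data.Nat.Combinatorics using (_C_)
open import Data.Integer using (+_)
open import Data.Rational as ℚ using (ℚ; 1ℚ; 0ℚ)
open import Data.Bool using (Bool; true; false; _∧_; _∨_; not; if_then_else_)
open import Data.Fin using (Fin; _≟_; toℕ)
open import Data.Fin.Subset using (Subset; inside; outside; ∣_∣)
open import Data.Vec using ([]; _∷_; lookup)
open import Data.List using (List; []; _∷_; _++_; map; foldr; concatMap; allFin)
open import Data.Nat.ListAction using (sum)
open import Data.Product using (Σ; _×_; ∃)
open import Data.Sum using (_⊎_)
open import Relation.Nullary.Decidable using (⌊_⌋)
open import Relation.Binary.PropositionalEquality using (_≡_)
open import Function.Definitions using (Injective)

record Graph (n : ℕ) : Set where
  field
    adj    : Fin n → Fin n → Bool
    sym    : ∀ i j → adj i j ≡ adj j i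
    irrefl : ∀ i → adj i i ≡ false
open Graph public

induced : ∀ {n m} (G : Graph n) (f : Fin m → Fin n) → Graph m
induced G f = record
  { adj    = λ i j → adj G (f i) (f j)
  ; sym    = λ i j → sym G (f i) (f j)
  ; irrefl = λ i → irrefl G (f i)
  }

Family : Set₁
Family = (n : ℕ) → Graph n → Set

Hereditary : Family → Set
Hereditary F = ∀ {n m} (G : Graph n) (f : Fin m → Fin n) →
  Injective _≡_ _≡_ f → F n G → F m (induced G f)

all : ∀ {A : Set} → (A → Bool) → List A → Bool
all p = foldr (λ x b → p x ∧ b) true

_∈ᵇ_ : ∀ {n} → Fin n → Subset n → Bool
i ∈ᵇ S = lookup S i

pairs : ∀ n → List (Fin n)  → List (Fin n × Fin n)
pairs n xs = concatMap (λ i → map (λ j → (i Data.Product., j)) (allFin n)) xs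
  where import Data.Product

isClique : ∀ {n} → Graph n → Subset n → Bool
isClique {n} G S = all (λ p → let i = Data.Product.proj₁ p ; j = Data.Product.proj₂ p in
  not (i ∈ᵇ S ∧ j ∈ᵇ S ∧ not ⌊ i ≟ j ⌋) ∨ adj G i j) (pairs n (allFin n))
  where import Data.Product

isIndep : ∀ {n} → Graph n → Subset n → Bool
isIndep {n} G S = all (λ p → let i = Data.Product.proj₁ p ; j = Data.Product.proj₂ p in
  not (i ∈ᵇ S ∧ j ∈ᵇ S ∧ not ⌊ i ≟ j ⌋) ∨ not (adj G i j)) (pairs n (allFin n))
  where import Data.Product

allSubsets : ∀ n → List (Subset n)
allSubsets zero    = [] ∷ []
allSubsets (suc n) = map (inside ∷_) (allSubsets n) ++ map (outside ∷_) (allSubsets n)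

hom : ∀ {n} → Graph n → ℕ
hom {n} G = foldr _⊔_ 0
  (map (λ S → if isClique G S ∨ isIndep G S then ∣ S ∣ else 0) (allSubsets n))

-- Erdős–Hajnal property, with exponent c = p / q > 0 (p, q ≥ 1):
-- hom(G) ≥ n^(p/q)  ⟺  n^p ≤ hom(G)^q.
ErdosHajnal : Family → Set
ErdosHajnal F = Σ ℕ λ p → Σ ℕ λ q → 1 ≤ p × 1 ≤ q ×
  (∀ n (G : Graph n) → F n G → n ℕ.^ p ≤ hom G ℕ.^ q)

toℚ : ℕ → ℚ
toℚ k = (+ k) ℚ./ 1

_^ℚ_ : ℚ → ℕ → ℚ
x ^ℚ zero  = 1ℚ
x ^ℚ suc k = x ℚ.* (x ^ℚ k)

edgesIn : ∀ {n} → Graph n → Subset n → ℕ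
edgesIn {n} G S = sum (map (λ p → let i = Data.Product.proj₁ p ; j = Data.Product.proj₂ p in
  if i ∈ᵇ S ∧ j ∈ᵇ S ∧ ⌊ toℕ i ℕ.<? toℕ j ⌋ ∧ adj G i j then 1 else 0) (pairs n (allFin n)))
  where import Data.Product

-- S is ε-homogeneous: edge density e(S) / C(|S|,2) is ≤ ε or ≥ 1 - ε
-- (written without division; sets with |S| ≤ 1 count as homogeneous).
Homogeneous : ∀ {n} → Graph n → ℚ → Subset n → Set
Homogeneous G ε S =
  (toℚ (edgesIn G S) ℚ.≤ ε ℚ.* toℚ (∣ S ∣ C 2)) ⊎
  ((1ℚ ℚ.- ε) ℚ.* toℚ (∣ S ∣ C 2) ℚ.≤ toℚ (edgesIn G S))

PolyRodl : Family → Set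
PolyRodl F = Σ ℕ λ C → ∀ (ε : ℚ) → 0ℚ ℚ.< ε → ε ℚ.< ℚ.½ →
  ∀ n (G : Graph n) → F n G →
  Σ (Subset n) λ S → Homogeneous G ε S × ((ε ^ℚ C) ℚ.* toℚ n ℚ.≤ toℚ ∣ S ∣)

{-# OPTIONS --safe #-}

-- If G has no ε-homogeneous set of size δn, then every set of at least δn vertices contains a vertex
-- of large degree, in G and in its complement.  By the Kleitman–Winston argument G then has very few
-- homogeneous sets of size t, where t is a suitable power of 1/ε.  Deleting at each step the vertex
-- that lies in the most of them leaves an induced subgraph on t^q vertices with no homogeneous set
-- of size t, which contradicts the Erdős–Hajnal property hom(G)^q ≥ n.
-- Conversely, a 1/r²-homogeneous set of at least r vertices has, after the same deletion process
-- applied to its edges or non-edges, an r-subset with no edges or no non-edges; taking r to be a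
-- small power of n gives the Erdős–Hajnal property.
module Submission where

open import Defs hiding (sym)
open import Data.Bool using (Bool; true; false; not; _∧_; _∨_; if_then_else_)
open import Data.Bool.Properties using (∧-zeroʳ; not-injective; not-involutive)
open import Data.Empty using (⊥)
open import Data.Fin as Fin using (Fin; zero; suc; toℕ)
open import Data.Fin.Properties using (toℕ-injective)
open import Data.Fin.Subset using (Subset; ∣_∣)
open import Data.Fin.Subset.Properties using (anySubset?)
open import Data.Integer as ℤ using (+[1+_]; -[1+_]) renaming (+_ to pos)
import Data.Integer.Properties as ℤ
open import Data.List as List using (List; []; _∷_; length; filterᵇ; map; foldr; tabulate; allFin)
open import Data.List.Properties
  using (map-++; map-∘; map-tabulate; tabulate-cong; tabulate-lookup; length-tabulate)
open import Data.List.Membership.Propositional using (_∈_; lose)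
open import Data.List.Membership.Propositional.Properties
  using (∈-concatMap⁺; ∈-map⁺; ∈-allFin; ∈-++⁺ˡ; ∈-++⁺ʳ; ∈-lookup)
open import Data.List.Relation.Binary.Permutation.Propositional
  using (_↭_; refl; prep; swap; trans; ↭-refl; ↭-trans)
open import Data.List.Relation.Binary.Permutation.Propositional.Properties
  using (filter-↭; ↭-length)
open import Data.List.Relation.Binary.Sublist.Propositional
  using (_⊆_; []; _∷_; _∷ʳ_; ⊆-refl; ⊆-trans; minimum)
open import Data.List.Relation.Binary.Sublist.Propositional.Properties
  using (All-resp-⊆; length-mono-≤)
open import Data.List.Relation.Unary.All as All using (All; []; _∷_)
open import Data.List.Relation.Unary.AllPairs using (AllPairs; []; _∷_)
open import Data.List.Relation.Unary.Any using (here; there)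
open import Data.List.Relation.Unary.Unique.Propositional using (Unique)
open import Data.List.Relation.Unary.Unique.Propositional.Properties using (allFin⁺)
open import Data.Nat
open import Data.Nat.Combinatorics using (_C_; nC1≡n; nCk+nC[k+1]≡[n+1]C[k+1])
open import Data.Nat.DivMod using (m/n*n≤m; m≡m%n+[m/n]*n; m%n<n; m≥n⇒m/n>0)
open import Data.Nat.ListAction using (sum)
open import Data.Nat.ListAction.Properties using (sum-++)
open import Data.Nat.Properties
open import Data.Nat.Tactic.RingSolver using (solve-∀)
open import Data.Product using (∃; _×_; _,_; proj₁; proj₂)
open import Data.Rational as ℚ
  using (ℚ; mkℚ; 0ℚ; 1ℚ; ½; *<*; toℚᵘ; fromℚᵘ; Positive; NonNegative; positive; nonNegative)
import Data.Rational.Properties as ℚ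
open import Data.Rational.Solver using (module +-*-Solver)
open import Data.Rational.Unnormalised as ℚᵘ using (mkℚᵘ; *≡*; *≤*; _≃_)
import Data.Rational.Unnormalised.Properties as ℚᵘ
open import Data.Sum using (_⊎_; inj₁; inj₂)
open import Data.Vec using ([]; _∷_; lookup)
open import Function using (_∘_; id)
open import Function.Definitions using (Injective)
open import Relation.Binary.Definitions using (tri<; tri≈; tri>)
open import Relation.Binary.PropositionalEquality as ≡
  using (_≡_; refl; sym; cong; cong₂; subst; subst₂; module ≡-Reasoning)
open import Relation.Nullary using (yes; no; contradiction)
open import Relation.Nullary.Decidable using (⌊_⌋; T?; isYes≗does; _×-dec_; _⊎-dec_)

-- Counting cliques in lists

-- The count has to win with a margin. Thinning `n` vertices to `m = t ^ q` multiplies the number of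
-- homogeneous `t`-sets by at most `(m / n) ^ t`, while the Kleitman-Winston bound leaves about
-- `(1 + D) ^ j * (n / D) ^ t` of them. So `D` must exceed `m` by a polynomial factor, and `t` must
-- exceed a multiple of the number `j` of shrinking rounds. These demands are circular: `m`, hence
-- `D`, hence `j`, depend on `t`. Writing `t = k ^ r`, with `k` an integer just above `1/ε`, breaks
-- the circle: `D = k ^ e` with `e` linear in `r`, so `j = k * k * e` is linear in `r` while `t` is
-- exponential in it. Cliques and independent sets are thinned together, as one count, since the
-- Erdős-Hajnal hypothesis only promises that one of the two kinds survives. Ratios are
-- cross-multiplied, so the counting stays in the natural numbers.

BoolRel : Set → Set
BoolRel A = A → A → Bool

Sym : {A : Set} → BoolRel A → Set
Sym R = ∀ x y → R x y ≡ R y x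

-- Vertex sets are lists, so that a neighbourhood is a `filterᵇ` and a chosen vertex can be moved to
-- the front by a permutation. `R` is tested only between distinct positions, so adjacency and
-- non-adjacency, which differ on the diagonal, can be treated alike.
cliques : {A : Set} → BoolRel A → ℕ → List A → ℕ
cliques R zero    xs       = 1
cliques R (suc t) []       = 0
cliques R (suc t) (x ∷ xs) = cliques R (suc t) xs + cliques R t (filterᵇ (R x) xs)

filterᵇ-comm : {A : Set} (p q : A → Bool) (xs : List A) →
  filterᵇ p (filterᵇ q xs) ≡ filterᵇ q (filterᵇ p xs)
filterᵇ-comm p q [] = refl
filterᵇ-comm p q (x ∷ xs) with p x in px | q x in qx
... | true  | true  rewrite px | qx = cong (x ∷_) (filterᵇ-comm p q xs)
... | true  | false rewrite qx = filterᵇ-comm p q xs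
... | false | true  rewrite px = filterᵇ-comm p q xs
... | false | false = filterᵇ-comm p q xs

cliques-swap : {A : Set} (R : BoolRel A) → Sym R → ∀ t x y xs →
  cliques R t (x ∷ y ∷ xs) ≡ cliques R t (y ∷ x ∷ xs)
cliques-swap R R-sym zero x y xs = refl
cliques-swap R R-sym (suc zero) x y xs = refl
cliques-swap R R-sym (suc (suc t)) x y xs with R x y in Rxy
... | true  rewrite ≡.trans (R-sym y x) Rxy | filterᵇ-comm (R x) (R y) xs =
  exchange (cliques R (2 + t) xs) _ _ _
  where
  exchange : ∀ a b c d → a + b + (c + d) ≡ a + c + (b + d)
  exchange = solve-∀
... | false rewrite ≡.trans (R-sym y x) Rxy =
  exchange (cliques R (2 + t) xs) _ _
  where
  exchange : ∀ a b c → a + b + c ≡ a + c + b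
  exchange = solve-∀

cliques-↭ : {A : Set} (R : BoolRel A) → Sym R → ∀ t {xs ys} →
  xs ↭ ys → cliques R t xs ≡ cliques R t ys
cliques-↭ R R-sym zero p = refl
cliques-↭ R R-sym (suc t) refl = refl
cliques-↭ R R-sym (suc t) (prep x p) =
  cong₂ _+_ (cliques-↭ R R-sym (suc t) p) (cliques-↭ R R-sym t (filter-↭ (T? ∘ R x) p))
cliques-↭ R R-sym (suc t) (swap {xs} x y p) = ≡.trans (cliques-swap R R-sym (suc t) x y xs)
  (cong₂ _+_
    (cong₂ _+_ (cliques-↭ R R-sym (suc t) p) (cliques-↭ R R-sym t (filter-↭ (T? ∘ R x) p)))
    (cliques-↭ R R-sym t (filter-↭ (T? ∘ R y) (prep x p))))
cliques-↭ R R-sym (suc t) (trans p q) =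
  ≡.trans (cliques-↭ R R-sym (suc t) p) (cliques-↭ R R-sym (suc t) q)

cliques-map : {A B : Set} (R : BoolRel B) (f : A → B) → ∀ t xs →
  cliques (λ x y → R (f x) (f y)) t xs ≡ cliques R t (map f xs)
cliques-map R f zero xs = refl
cliques-map R f (suc t) [] = refl
cliques-map R f (suc t) (x ∷ xs) = cong₂ _+_ (cliques-map R f (suc t) xs)
  (≡.trans (cliques-map R f t (filterᵇ (R (f x) ∘ f) xs))
    (cong (cliques R t) (map-filterᵇ xs)))
  where
  map-filterᵇ : ∀ zs → map f (filterᵇ (R (f x) ∘ f) zs) ≡ filterᵇ (R (f x)) (map f zs)
  map-filterᵇ [] = refl
  map-filterᵇ (z ∷ zs) with R (f x) (f z)
  ... | true  = cong (f z ∷_) (map-filterᵇ zs)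
  ... | false = map-filterᵇ zs

filterᵇ-⊆ : {A : Set} (p : A → Bool) (xs : List A) → filterᵇ p xs ⊆ xs
filterᵇ-⊆ p [] = []
filterᵇ-⊆ p (x ∷ xs) with p x
... | true  = refl ∷ filterᵇ-⊆ p xs
... | false = x ∷ʳ filterᵇ-⊆ p xs

filterᵇ-mono-⊆ : {A : Set} (p : A → Bool) {xs ys : List A} →
  xs ⊆ ys → filterᵇ p xs ⊆ filterᵇ p ys
filterᵇ-mono-⊆ p [] = []
filterᵇ-mono-⊆ p (y ∷ʳ s) with p y
... | true  = y ∷ʳ filterᵇ-mono-⊆ p s
... | false = filterᵇ-mono-⊆ p s
filterᵇ-mono-⊆ p (_∷_ {x} refl s) with p x
... | true  = refl ∷ filterᵇ-mono-⊆ p s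
... | false = filterᵇ-mono-⊆ p s

cliques-mono-⊆ : {A : Set} (R : BoolRel A) → ∀ t {xs ys} →
  xs ⊆ ys → cliques R t xs ≤ cliques R t ys
cliques-mono-⊆ R zero s = ≤-refl
cliques-mono-⊆ R (suc t) [] = z≤n
cliques-mono-⊆ R (suc t) (y ∷ʳ s) = m≤n⇒m≤n+o _ (cliques-mono-⊆ R (suc t) s)
cliques-mono-⊆ R (suc t) (_∷_ {x} refl s) =
  +-mono-≤ (cliques-mono-⊆ R (suc t) s) (cliques-mono-⊆ R t (filterᵇ-mono-⊆ (R x) s))

cliques≤length^ : {A : Set} (R : BoolRel A) → ∀ t xs → cliques R t xs ≤ length xs ^ t
cliques≤length^ R zero xs = ≤-refl
cliques≤length^ R (suc t) [] = z≤n
cliques≤length^ R (suc t) (x ∷ xs) = begin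
  cliques R (suc t) xs + cliques R t (filterᵇ (R x) xs)
    ≤⟨ +-mono-≤ (cliques≤length^ R (suc t) xs)
         (≤-trans (cliques-mono-⊆ R t (filterᵇ-⊆ (R x) xs)) (cliques≤length^ R t xs)) ⟩
  ℓ * ℓ ^ t + ℓ ^ t
    ≡⟨ +-comm (ℓ * ℓ ^ t) (ℓ ^ t) ⟩
  suc ℓ * ℓ ^ t
    ≤⟨ *-monoʳ-≤ (suc ℓ) (^-monoˡ-≤ t (n≤1+n ℓ)) ⟩
  suc ℓ ^ suc t ∎
  where
  open ≤-Reasoning
  ℓ = length xs

AllPairs⇒cliques>0 : {A : Set} (R : BoolRel A) → ∀ t {xs} →
  AllPairs (λ x y → R x y ≡ true) xs → t ≤ length xs → 0 < cliques R t xs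
AllPairs⇒cliques>0 R zero ps t≤ = s≤s z≤n
AllPairs⇒cliques>0 R (suc t) {x ∷ xs} (p ∷ ps) (s≤s t≤) = m≤n⇒m≤o+n (cliques R (suc t) xs)
  (subst (λ ys → 0 < cliques R t ys) (sym (filterᵇ-all p)) (AllPairs⇒cliques>0 R t ps t≤))
  where
  filterᵇ-all : ∀ {zs} → All (λ y → R x y ≡ true) zs → filterᵇ (R x) zs ≡ zs
  filterᵇ-all [] = refl
  filterᵇ-all {z ∷ zs} (q ∷ qs) rewrite q = cong (z ∷_) (filterᵇ-all qs)

length-filterᵇ-not : {A : Set} (p q : A → Bool) → (∀ x → q x ≡ not (p x)) → ∀ xs →
  length (filterᵇ p xs) + length (filterᵇ q xs) ≡ length xs
length-filterᵇ-not p q q≡ [] = refl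
length-filterᵇ-not p q q≡ (x ∷ xs) rewrite q≡ x with p x
... | true  = cong suc (length-filterᵇ-not p q q≡ xs)
... | false = ≡.trans (+-suc _ _) (cong suc (length-filterᵇ-not p q q≡ xs))

cliques₁ : {A : Set} (R : BoolRel A) → ∀ xs → cliques R 1 xs ≡ length xs
cliques₁ R [] = refl
cliques₁ R (x ∷ xs) = ≡.trans (cong (_+ 1) (cliques₁ R xs)) (+-comm (length xs) 1)

C₂-suc : ∀ n → suc n C 2 ≡ n + n C 2
C₂-suc n = ≡.trans (sym (nCk+nC[k+1]≡[n+1]C[k+1] n 1)) (cong (_+ n C 2) (nC1≡n n))

2*C₂ : ∀ n → 2 * (suc n C 2) ≡ suc n * n
2*C₂ zero = refl
2*C₂ (suc n) = begin
  2 * (suc (suc n) C 2)         ≡⟨ cong (2 *_) (C₂-suc (suc n)) ⟩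
  2 * (suc n + suc n C 2)       ≡⟨ *-distribˡ-+ 2 (suc n) (suc n C 2) ⟩
  2 * suc n + 2 * (suc n C 2)   ≡⟨ cong (2 * suc n +_) (2*C₂ n) ⟩
  2 * suc n + suc n * n         ≡⟨ collect n ⟩
  suc (suc n) * suc n           ∎
  where
  open ≡-Reasoning
  collect : ∀ n → 2 * suc n + suc n * n ≡ suc (suc n) * suc n
  collect = solve-∀

-- Each pair belongs to exactly one of the two relations. This turns density at least `1 - ε` into
-- sparsity of the complement, so both kinds of homogeneity become one statement about two
-- relations.
cliques₂-not : {A : Set} (R R′ : BoolRel A) → (∀ x y → R′ x y ≡ not (R x y)) → ∀ xs →
  cliques R 2 xs + cliques R′ 2 xs ≡ length xs C 2
cliques₂-not R R′ R′≡ [] = refl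
cliques₂-not R R′ R′≡ (x ∷ xs) = begin
  cliques R 2 xs + cliques R 1 (filterᵇ (R x) xs) + (cliques R′ 2 xs + cliques R′ 1 (filterᵇ (R′ x) xs))
    ≡⟨ cong₂ (λ a b → cliques R 2 xs + a + (cliques R′ 2 xs + b))
         (cliques₁ R (filterᵇ (R x) xs)) (cliques₁ R′ (filterᵇ (R′ x) xs)) ⟩
  cliques R 2 xs + length (filterᵇ (R x) xs) + (cliques R′ 2 xs + length (filterᵇ (R′ x) xs))
    ≡⟨ exchange (cliques R 2 xs) _ _ _ ⟩
  length (filterᵇ (R x) xs) + length (filterᵇ (R′ x) xs) + (cliques R 2 xs + cliques R′ 2 xs)
    ≡⟨ cong₂ _+_ (length-filterᵇ-not (R x) (R′ x) (R′≡ x) xs) (cliques₂-not R R′ R′≡ xs) ⟩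
  length xs + length xs C 2
    ≡⟨ C₂-suc (length xs) ⟨
  suc (length xs) C 2 ∎
  where
  open ≡-Reasoning
  exchange : ∀ a b c d → a + b + (c + d) ≡ b + d + (a + c)
  exchange = solve-∀

-- Sums over single-entry deletions, and deletion by averaging

delSum : {A : Set} → (List A → ℕ) → List A → ℕ
delSum h []       = 0
delSum h (x ∷ xs) = h xs + delSum (h ∘ (x ∷_)) xs

delSum-cong : {A : Set} {g h : List A → ℕ} → (∀ xs → g xs ≡ h xs) → ∀ xs →
  delSum g xs ≡ delSum h xs
delSum-cong g≗h [] = refl
delSum-cong g≗h (x ∷ xs) = cong₂ _+_ (g≗h xs) (delSum-cong (g≗h ∘ (x ∷_)) xs)

delSum-+ : {A : Set} (g h : List A → ℕ) → ∀ xs →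
  delSum (λ ys → g ys + h ys) xs ≡ delSum g xs + delSum h xs
delSum-+ g h [] = refl
delSum-+ g h (x ∷ xs)
  rewrite delSum-+ (g ∘ (x ∷_)) (h ∘ (x ∷_)) xs = exchange (g xs) _ _ _
  where
  exchange : ∀ a b c d → a + b + (c + d) ≡ a + c + (b + d)
  exchange = solve-∀

delSum-const : {A : Set} (c : ℕ) (xs : List A) → delSum (λ _ → c) xs ≡ length xs * c
delSum-const c [] = refl
delSum-const c (x ∷ xs) = cong (c +_) (delSum-const c xs)

-- Deleting an entry that fails `p` leaves the filtered list unchanged, and there are
-- `length xs - length (filterᵇ p xs)` such entries. The extra term on the left avoids this
-- subtraction.
delSum-filterᵇ : {A : Set} (p : A → Bool) (h : List A → ℕ) → ∀ xs →
  delSum (h ∘ filterᵇ p) xs + length (filterᵇ p xs) * h (filterᵇ p xs) ≡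
  delSum h (filterᵇ p xs) + length xs * h (filterᵇ p xs)
delSum-filterᵇ p h [] = refl
delSum-filterᵇ p h (x ∷ xs) with p x
... | true  = begin
  h fxs + S′ + (h (x ∷ fxs) + length fxs * h (x ∷ fxs))
    ≡⟨ exchange (h fxs) _ _ _ ⟩
  h fxs + h (x ∷ fxs) + (S′ + length fxs * h (x ∷ fxs))
    ≡⟨ cong (h fxs + h (x ∷ fxs) +_) (delSum-filterᵇ p (h ∘ (x ∷_)) xs) ⟩
  h fxs + h (x ∷ fxs) + (delSum (h ∘ (x ∷_)) fxs + length xs * h (x ∷ fxs))
    ≡⟨ exchange (h fxs) _ _ _ ⟩
  h fxs + delSum (h ∘ (x ∷_)) fxs + (h (x ∷ fxs) + length xs * h (x ∷ fxs)) ∎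
  where
  open ≡-Reasoning
  fxs = filterᵇ p xs
  S′  = delSum (λ ys → h (x ∷ filterᵇ p ys)) xs
  exchange : ∀ a b c d → a + b + (c + d) ≡ a + c + (b + d)
  exchange = solve-∀
... | false = begin
  h fxs + delSum (h ∘ filterᵇ p) xs + length fxs * h fxs
    ≡⟨ +-assoc (h fxs) _ _ ⟩
  h fxs + (delSum (h ∘ filterᵇ p) xs + length fxs * h fxs)
    ≡⟨ cong (h fxs +_) (delSum-filterᵇ p h xs) ⟩
  h fxs + (delSum h fxs + length xs * h fxs)
    ≡⟨ exchange (h fxs) (delSum h fxs) _ ⟩
  delSum h fxs + (h fxs + length xs * h fxs) ∎
  where
  open ≡-Reasoning
  fxs = filterᵇ p xs
  exchange : ∀ a b c → a + (b + c) ≡ b + (a + c)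
  exchange = solve-∀

-- The double-counting identity for the number h xs of t-subsets of xs with some property.
Counts : {A : Set} → ℕ → (List A → ℕ) → Set
Counts t h = ∀ xs → delSum h xs + t * h xs ≡ length xs * h xs

-- A `t`-clique survives every deletion except those of its own `t` members. In the induction, the
-- cliques through the head are counted in a filtered list, and `delSum-filterᵇ` moves the deletions
-- there.
cliques-counts : {A : Set} (R : BoolRel A) → ∀ t → Counts t (cliques R t)
cliques-counts R zero xs = ≡.trans (+-identityʳ _) (delSum-const 1 xs)
cliques-counts R (suc t) [] = *-zeroʳ t
cliques-counts R (suc t) (x ∷ xs) = begin
  a + delSum (λ ys → cliques R (suc t) ys + cliques R t (filterᵇ (R x) ys)) xs + suc t * (a + b)
    ≡⟨ cong (λ z → a + z + suc t * (a + b))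
         (delSum-+ (cliques R (suc t)) (cliques R t ∘ filterᵇ (R x)) xs) ⟩
  a + (S₁ + S₂) + suc t * (a + b)
    ≡⟨ regroup a b S₁ S₂ t ⟩
  a + b + ((S₁ + suc t * a) + (S₂ + t * b))
    ≡⟨ cong₂ (λ y z → a + b + (y + z)) (cliques-counts R (suc t) xs) S₂-eq ⟩
  a + b + (length xs * a + length xs * b)
    ≡⟨ cong (a + b +_) (*-distribˡ-+ (length xs) a b) ⟨
  a + b + length xs * (a + b) ∎
  where
  open ≡-Reasoning
  fxs = filterᵇ (R x) xs
  a   = cliques R (suc t) xs
  b   = cliques R t fxs
  S₁  = delSum (cliques R (suc t)) xs
  S₂  = delSum (cliques R t ∘ filterᵇ (R x)) xs
  regroup : ∀ a b s₁ s₂ t →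
    a + (s₁ + s₂) + suc t * (a + b) ≡ a + b + ((s₁ + suc t * a) + (s₂ + t * b))
  regroup = solve-∀
  exchange : ∀ a b c → a + b + c ≡ a + c + b
  exchange = solve-∀
  S₂-eq : S₂ + t * b ≡ length xs * b
  S₂-eq = +-cancelʳ-≡ (length fxs * b) _ _ (begin
    S₂ + t * b + length fxs * b
      ≡⟨ exchange S₂ _ _ ⟩
    S₂ + length fxs * b + t * b
      ≡⟨ cong (_+ t * b) (delSum-filterᵇ (R x) (cliques R t) xs) ⟩
    delSum (cliques R t) fxs + length xs * b + t * b
      ≡⟨ exchange (delSum (cliques R t) fxs) _ _ ⟩
    delSum (cliques R t) fxs + t * b + length xs * b
      ≡⟨ cong (_+ length xs * b) (cliques-counts R t fxs) ⟩
    length fxs * b + length xs * b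
      ≡⟨ +-comm (length fxs * b) _ ⟩
    length xs * b + length fxs * b ∎)

Counts-+ : {A : Set} {t : ℕ} {g h : List A → ℕ} → Counts t g → Counts t h →
  Counts t (λ xs → g xs + h xs)
Counts-+ {t = t} {g} {h} cg ch xs = begin
  delSum (λ ys → g ys + h ys) xs + t * (g xs + h xs)
    ≡⟨ cong₂ _+_ (delSum-+ g h xs) (*-distribˡ-+ t (g xs) (h xs)) ⟩
  delSum g xs + delSum h xs + (t * g xs + t * h xs)
    ≡⟨ exchange (delSum g xs) _ _ _ ⟩
  delSum g xs + t * g xs + (delSum h xs + t * h xs)
    ≡⟨ cong₂ _+_ (cg xs) (ch xs) ⟩
  length xs * g xs + length xs * h xs
    ≡⟨ *-distribˡ-+ (length xs) (g xs) (h xs) ⟨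
  length xs * (g xs + h xs) ∎
  where
  open ≡-Reasoning
  exchange : ∀ a b c d → a + b + (c + d) ≡ a + c + (b + d)
  exchange = solve-∀

-- A minimum is at most the average. Both a permutation and a sublist are recorded: the first brings
-- `v` to the front for counting its neighbours, the second keeps the rest inside the original
-- vertex set.
cheapest-deletion : {A : Set} (h : List A → ℕ) → ∀ x xs → ∃ λ v → ∃ λ ys →
  (x ∷ xs ↭ v ∷ ys) × (ys ⊆ x ∷ xs) × suc (length xs) * h ys ≤ delSum h (x ∷ xs)
cheapest-deletion h x [] = x , [] , ↭-refl , x ∷ʳ [] , ≤-refl
cheapest-deletion h x (y ∷ xs) with cheapest-deletion (h ∘ (x ∷_)) y xs
... | v , ys , p , s , le with ≤-total (h (y ∷ xs)) (h (x ∷ ys))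
...   | inj₁ h≤ = x , y ∷ xs , ↭-refl , x ∷ʳ ⊆-refl ,
        +-monoʳ-≤ (h (y ∷ xs)) (≤-trans (*-monoʳ-≤ (suc (length xs)) h≤) le)
...   | inj₂ h≥ = v , x ∷ ys , ↭-trans (prep x p) (swap x v ↭-refl) , refl ∷ s ,
        +-mono-≤ h≥ le

deletion : {A : Set} {t : ℕ} {h : List A → ℕ} → Counts t h → ∀ b xs → length xs ≡ suc b →
  ∃ λ v → ∃ λ ys → (xs ↭ v ∷ ys) × (ys ⊆ xs) × suc b * h ys + t * h xs ≤ suc b * h xs
deletion {t = t} {h} ch b (x ∷ xs) refl with cheapest-deletion h x xs
... | v , ys , p , s , le = v , ys , p , s ,
  ≤-trans (+-monoˡ-≤ (t * h (x ∷ xs)) le) (≤-reflexive (ch (x ∷ xs)))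

-- Bernoulli's inequality `1 - t / (1 + b) ≤ (b / (1 + b)) ^ t`, multiplied by `(1 + b) ^ (1 + t)`.
-- It converts the loss from one averaged deletion into the ratio of `t`-th powers of lengths, which
-- telescopes.
bernoulli : ∀ b t → suc b * suc b ^ t ≤ suc b * b ^ t + t * suc b ^ t
bernoulli b zero = ≤-reflexive (sym (+-identityʳ _))
bernoulli b (suc t) = begin
  suc b * (suc b * P)                          ≡⟨ refl ⟩
  suc b * P + b * (suc b * P)                  ≤⟨ +-monoʳ-≤ (suc b * P) (*-monoʳ-≤ b (bernoulli b t)) ⟩
  suc b * P + b * (suc b * Q + t * P)          ≤⟨ m≤m+n _ (t * P) ⟩
  suc b * P + b * (suc b * Q + t * P) + t * P  ≡⟨ regroup b t P Q ⟩
  suc b * (b * Q) + suc t * (suc b * P)        ∎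
  where
  open ≤-Reasoning
  P = suc b ^ t
  Q = b ^ t
  regroup : ∀ b t p q →
    suc b * p + b * (suc b * q + t * p) + t * p ≡ suc b * (b * q) + suc t * (suc b * p)
  regroup = solve-∀

deletion-density : {A : Set} {t : ℕ} {h : List A → ℕ} → Counts t h → ∀ b xs → length xs ≡ suc b →
  ∃ λ ys → (ys ⊆ xs) × (length ys ≡ b) × h ys * suc b ^ t ≤ h xs * b ^ t
deletion-density {t = t} {h} ch b xs ℓ with deletion {t = t} {h} ch b xs ℓ
... | v , ys , p , s , le = ys , s , suc-injective (≡.trans (sym (↭-length p)) ℓ) ,
  *-cancelˡ-≤ (suc b) (+-cancelʳ-≤ (t * H * P) _ _ (begin
    suc b * (h ys * P) + t * H * P      ≡⟨ collect (suc b) (h ys) P (t * H) ⟩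
    (suc b * h ys + t * H) * P          ≤⟨ *-monoˡ-≤ P le ⟩
    suc b * H * P                       ≡⟨ pull (suc b) H P ⟩
    H * (suc b * P)                     ≤⟨ *-monoʳ-≤ H (bernoulli b t) ⟩
    H * (suc b * b ^ t + t * P)         ≡⟨ spread (suc b) H (b ^ t) t P ⟩
    suc b * (H * b ^ t) + t * H * P     ∎))
  where
  open ≤-Reasoning
  H = h xs
  P = suc b ^ t
  collect : ∀ a b c d → a * (b * c) + d * c ≡ (a * b + d) * c
  collect = solve-∀
  pull : ∀ a b c → a * b * c ≡ b * (a * c)
  pull = solve-∀
  spread : ∀ a h q t p → h * (a * q + t * p) ≡ a * (h * q) + t * h * p
  spread = solve-∀

-- Deleting at each step a vertex lying in at least the average number of counted sets.
sparsify : {A : Set} {t : ℕ} {h : List A → ℕ} → Counts t h → ∀ m xs → m ≤ length xs → ∃ λ ys →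
  (ys ⊆ xs) × (length ys ≡ m) × h ys * length xs ^ t ≤ h xs * m ^ t
sparsify {A} {t} {h} ch m xs m≤ = go (length xs) xs refl m≤
  where
  open ≤-Reasoning
  exchange : ∀ a b c → a * b * c ≡ a * c * b
  exchange = solve-∀
  go : ∀ b xs → length xs ≡ b → m ≤ b → ∃ λ ys →
    (ys ⊆ xs) × (length ys ≡ m) × h ys * b ^ t ≤ h xs * m ^ t
  go zero xs ℓ z≤n = xs , ⊆-refl , ℓ , ≤-refl
  go (suc b) xs ℓ m≤sb with m≤n⇒m<n∨m≡n m≤sb
  ... | inj₂ refl = xs , ⊆-refl , ℓ , ≤-refl
  ... | inj₁ (s≤s m≤b) with deletion-density {t = t} {h} ch b xs ℓ | m≤n⇒m<n∨m≡n m≤b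
  -- Stopping at `b = m` leaves `m < b` in the other case, so that `b ^ t` is nonzero and can be
  -- cancelled.
  ...   | ys , s , ℓys , le | inj₂ refl = ys , s , ℓys , le
  ...   | ys , s , ℓys , le | inj₁ m<b with go b ys ℓys m≤b
  ...     | zs , s′ , ℓzs , le′ = zs , ⊆-trans s′ s , ℓzs ,
    *-cancelʳ-≤ _ _ (b ^ t) {{m^n≢0 b t {{>-nonZero (≤-<-trans z≤n m<b)}}}} (begin
      h zs * suc b ^ t * b ^ t      ≡⟨ exchange (h zs) _ _ ⟩
      h zs * b ^ t * suc b ^ t      ≤⟨ *-monoˡ-≤ (suc b ^ t) le′ ⟩
      h ys * m ^ t * suc b ^ t      ≡⟨ exchange (h ys) _ _ ⟩
      h ys * suc b ^ t * m ^ t      ≤⟨ *-monoˡ-≤ (m ^ t) le ⟩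
      h xs * b ^ t * m ^ t          ≡⟨ exchange (h xs) _ _ ⟩
      h xs * m ^ t * b ^ t          ∎)

-- Relations with a dense complement have few cliques

Complementary : {A : Set} → BoolRel A → BoolRel A → Set
Complementary R R′ = ∀ x y → R′ x y ≡ not (R x y)

-- Averaged deletion with `t = 2` finds a vertex of at least average `R′`-degree `d`; density above
-- `1 / k` makes `k * d` at least `suc b`, and the other `b - d` vertices are the `R`-neighbours.
high-degree-vertex : {A : Set} (R R′ : BoolRel A) → Sym R′ → Complementary R R′ →
  ∀ k b xs → length xs ≡ suc b → suc b C 2 < k * cliques R′ 2 xs →
  ∃ λ v → ∃ λ ys → (xs ↭ v ∷ ys) × (ys ⊆ xs) × k * length (filterᵇ (R v) ys) + suc b ≤ k * b
high-degree-vertex R R′ R′-sym R′≡ k b xs ℓ dense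
  with deletion {t = 2} {cliques R′ 2} (cliques-counts R′ 2) b xs ℓ
... | v , ys , p , s , le = v , ys , p , s , (begin
  k * f + suc b      ≤⟨ +-monoʳ-≤ (k * f) b<kd ⟩
  k * f + k * d      ≡⟨ *-distribˡ-+ k f d ⟨
  k * (f + d)        ≡⟨ cong (k *_) (≡.trans (length-filterᵇ-not (R v) (R′ v) (R′≡ v) ys)
                          (suc-injective (≡.trans (sym (↭-length p)) ℓ))) ⟩
  k * b              ∎)
  where
  open ≤-Reasoning
  f = length (filterᵇ (R v) ys)
  d = length (filterᵇ (R′ v) ys)
  e = cliques R′ 2 xs
  e′ = cliques R′ 2 ys
  e≡ : e ≡ e′ + d
  e≡ = ≡.trans (cliques-↭ R′ R′-sym 2 p) (cong (e′ +_) (cliques₁ R′ (filterᵇ (R′ v) ys)))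
  2e≤ : 2 * e ≤ suc b * d
  2e≤ = +-cancelˡ-≤ (suc b * e′) _ _ (≤-trans le (≤-reflexive
    (≡.trans (cong (suc b *_) e≡) (*-distribˡ-+ (suc b) e′ d))))
  exchange : ∀ a b c → a * (b * c) ≡ b * (a * c)
  exchange = solve-∀
  b<kd : b < k * d
  b<kd = *-cancelˡ-< (suc b) b (k * d) (begin-strict
    suc b * b           ≡⟨ 2*C₂ b ⟨
    2 * (suc b C 2)     <⟨ *-monoʳ-< 2 dense ⟩
    2 * (k * e)         ≡⟨ exchange 2 k e ⟩
    k * (2 * e)         ≤⟨ *-monoʳ-≤ k 2e≤ ⟩
    k * (suc b * d)     ≡⟨ exchange k (suc b) d ⟩
    suc b * (k * d)     ∎)

-- The Kleitman–Winston argument: a vertex of at least average R′-degree is R-related to at most a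
-- fraction c / (1 + c) of the remaining vertices, so a clique can use such vertices only j times
-- before it is confined to at most L vertices.
cliques-bound : {A : Set} (R R′ : BoolRel A) → Sym R → Sym R′ → Complementary R R′ →
  ∀ c D L (V : List A) → length V ≤ D * L →
  (∀ xs → xs ⊆ V → L < length xs → length xs C 2 < suc c * cliques R′ 2 xs) →
  ∀ j t xs → xs ⊆ V → length xs * c ^ j ≤ L * suc c ^ j →
  cliques R t xs ≤ suc D ^ j * L ^ t
cliques-bound {A} R R′ R-sym R′-sym R′≡ c D L V V≤ dense = go
  where
  open ≤-Reasoning
  k = suc c
  small : ∀ t xs → length xs ≤ L → cliques R t xs ≤ L ^ t
  small t xs ℓ≤ = ≤-trans (cliques≤length^ R t xs) (^-monoˡ-≤ t ℓ≤)
  -- The last hypothesis says that `j` shrinkings by the factor `c / k` bring the list down to at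
  -- most `L` entries.
  go : ∀ j t xs → xs ⊆ V → length xs * c ^ j ≤ L * k ^ j → cliques R t xs ≤ suc D ^ j * L ^ t
  go zero t xs s level = ≤-trans
    (small t xs (≤-trans (≤-reflexive (sym (*-identityʳ (length xs))))
      (≤-trans level (≤-reflexive (*-identityʳ L)))))
    (≤-reflexive (sym (*-identityˡ (L ^ t))))
  go (suc j) zero xs s level =
    ≤-trans (m^n>0 (suc D) (suc j)) (≤-reflexive (sym (*-identityʳ _)))
  go (suc j) (suc t) xs s level = begin
    cliques R (suc t) xs
      ≤⟨ shrink (length xs) xs refl s level ⟩
    P * (L * Q) + length xs * (P * Q)
      -- At most `D * L` vertices are split off at one level, which accounts for one factor `suc D`.
      ≤⟨ +-monoʳ-≤ (P * (L * Q)) (*-monoˡ-≤ (P * Q) (≤-trans (length-mono-≤ s) V≤)) ⟩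
    P * (L * Q) + D * L * (P * Q)
      ≡⟨ regroup D L P Q ⟩
    suc D * P * (L * Q) ∎
    where
    P = suc D ^ j
    Q = L ^ t
    regroup : ∀ d l p q → p * (l * q) + d * l * (p * q) ≡ suc d * p * (l * q)
    regroup = solve-∀
    -- While more than `L` vertices remain, a vertex `v` of high `R′`-degree is split off. The
    -- cliques through `v` continue in `fys`, one level lower, and number at most `P * Q`; those
    -- avoiding `v` stay at the same level with one vertex fewer.
    shrink : ∀ b xs → length xs ≡ b → xs ⊆ V → length xs * c ^ suc j ≤ L * k ^ suc j →
      cliques R (suc t) xs ≤ P * (L * Q) + b * (P * Q)
    shrink b xs ℓ s level with length xs ≤? L
    ... | yes ℓ≤L = begin
      cliques R (suc t) xs       ≤⟨ small (suc t) xs ℓ≤L ⟩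
      L * Q                      ≤⟨ m≤n*m (L * Q) P {{m^n≢0 (suc D) j}} ⟩
      P * (L * Q)                ≤⟨ m≤m+n _ _ ⟩
      P * (L * Q) + b * (P * Q)  ∎
    shrink zero xs ℓ s level | no ℓ≰L = contradiction (≤-trans (≤-reflexive ℓ) z≤n) ℓ≰L
    shrink (suc b) xs ℓ s level | no ℓ≰L
      with high-degree-vertex R R′ R′-sym R′≡ k b xs ℓ
             (subst (λ z → z C 2 < k * cliques R′ 2 xs) ℓ (dense xs s (≰⇒> ℓ≰L)))
    ... | v , ys , p , s′ , deg = begin
      cliques R (suc t) xs
        ≡⟨ cliques-↭ R R-sym (suc t) p ⟩
      cliques R (suc t) ys + cliques R t fys
        ≤⟨ +-mono-≤ (shrink b ys ℓys (⊆-trans s′ s) level-ys)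
             (go j t fys (⊆-trans (filterᵇ-⊆ (R v) ys) (⊆-trans s′ s)) level-fys) ⟩
      P * (L * Q) + b * (P * Q) + P * Q
        ≡⟨ collect (P * (L * Q)) b (P * Q) ⟩
      P * (L * Q) + suc b * (P * Q) ∎
      where
      fys = filterᵇ (R v) ys
      f = length fys
      ℓys : length ys ≡ b
      ℓys = suc-injective (≡.trans (sym (↭-length p)) ℓ)
      level-ys : length ys * c ^ suc j ≤ L * k ^ suc j
      level-ys = ≤-trans (*-monoˡ-≤ (c ^ suc j) (length-mono-≤ s′)) level
      collect : ∀ a b x → a + b * x + x ≡ a + suc b * x
      collect = solve-∀
      kf≤cb : k * f ≤ c * b
      kf≤cb = +-cancelʳ-≤ b _ _ (begin
        k * f + b       ≤⟨ +-monoʳ-≤ (k * f) (n≤1+n b) ⟩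
        k * f + suc b   ≤⟨ deg ⟩
        b + c * b       ≡⟨ +-comm b _ ⟩
        c * b + b       ∎)
      pull : ∀ a b c → c * (a * b) ≡ c * a * b
      pull = solve-∀
      turn : ∀ c b x → c * b * x ≡ b * (c * x)
      turn = solve-∀
      turn′ : ∀ c b x → b * (c * x) ≡ c * (b * x)
      turn′ = solve-∀
      level-fys : f * c ^ j ≤ L * k ^ j
      level-fys = *-cancelˡ-≤ k (begin
        k * (f * c ^ j)         ≡⟨ pull f (c ^ j) k ⟩
        k * f * c ^ j           ≤⟨ *-monoˡ-≤ (c ^ j) kf≤cb ⟩
        c * b * c ^ j           ≡⟨ turn c b (c ^ j) ⟩
        b * (c * c ^ j)         ≤⟨ *-monoˡ-≤ (c ^ suc j) (≤-trans (n≤1+n b) (≤-reflexive (sym ℓ))) ⟩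
        length xs * c ^ suc j   ≤⟨ level ⟩
        L * (k * k ^ j)         ≡⟨ turn′ k L (k ^ j) ⟩
        k * (L * k ^ j)         ∎)

-- Growth estimates that fix the parameters

n<2^n : ∀ n → n < 2 ^ n
n<2^n zero = s≤s z≤n
n<2^n (suc n) = begin-strict
  suc n              ≤⟨ n<2^n n ⟩
  2 ^ n              <⟨ m<m+n (2 ^ n) (m^n>0 2 n) ⟩
  2 ^ n + 2 ^ n      ≡⟨ cong (2 ^ n +_) (+-identityʳ (2 ^ n)) ⟨
  2 * 2 ^ n          ∎
  where open ≤-Reasoning

-- Bernoulli's inequality `1 + t / c ≤ (1 + 1 / c) ^ t`, multiplied by `c * c ^ t`.
bernoulli⁺ : ∀ c t → (c + t) * c ^ t ≤ c * suc c ^ t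
bernoulli⁺ c zero = ≤-reflexive (cong (_* 1) (+-identityʳ c))
bernoulli⁺ c (suc t) = begin
  (c + suc t) * (c * P)                ≤⟨ m≤m+n _ (t * P) ⟩
  (c + suc t) * (c * P) + t * P        ≡⟨ regroup c t P ⟩
  suc c * ((c + t) * P)                ≤⟨ *-monoʳ-≤ (suc c) (bernoulli⁺ c t) ⟩
  suc c * (c * Q)                      ≡⟨ exchange (suc c) c Q ⟩
  c * (suc c * Q)                      ∎
  where
  open ≤-Reasoning
  P = c ^ t
  Q = suc c ^ t
  regroup : ∀ c t p → (c + suc t) * (c * p) + t * p ≡ suc c * ((c + t) * p)
  regroup = solve-∀
  exchange : ∀ a b c → a * (b * c) ≡ b * (a * c)
  exchange = solve-∀

2*c^k≤k^k : ∀ c → 0 < c → 2 * c ^ suc c ≤ suc c ^ suc c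
2*c^k≤k^k c 0<c = begin
  2 * (c * c ^ c)          ≡⟨ regroup c (c ^ c) ⟩
  (c + c) * c ^ c          ≤⟨ bernoulli⁺ c c ⟩
  c * suc c ^ c            ≤⟨ *-monoˡ-≤ (suc c ^ c) (n≤1+n c) ⟩
  suc c * suc c ^ c        ∎
  where
  open ≤-Reasoning
  regroup : ∀ c p → 2 * (c * p) ≡ (c + c) * p
  regroup = solve-∀

^-distribʳ-* : ∀ t a b → (a * b) ^ t ≡ a ^ t * b ^ t
^-distribʳ-* zero a b = refl
^-distribʳ-* (suc t) a b = ≡.trans (cong (a * b *_) (^-distribʳ-* t a b)) (interchange a b _ _)
  where
  interchange : ∀ a b p q → a * b * (p * q) ≡ a * p * (b * q)
  interchange = solve-∀

^-scale : ∀ a c k j i → a * c ^ j ≤ k ^ j → a ^ i * c ^ (j * i) ≤ k ^ (j * i)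
^-scale a c k j i le = begin
  a ^ i * c ^ (j * i)      ≡⟨ cong (a ^ i *_) (^-*-assoc c j i) ⟨
  a ^ i * (c ^ j) ^ i      ≡⟨ ^-distribʳ-* i a (c ^ j) ⟨
  (a * c ^ j) ^ i          ≤⟨ ^-monoˡ-≤ i le ⟩
  (k ^ j) ^ i              ≡⟨ ^-*-assoc k j i ⟩
  k ^ (j * i)              ∎
  where open ≤-Reasoning

-- For `k = suc c` one has `(k / c) ^ k ≥ 2`, so `(k / c) ^ (k * k) ≥ 2 ^ k ≥ k`: every `k * k`
-- shrinkings gain a factor `k`. With `i = e` this gives the number of rounds that takes `k ^ e * L`
-- vertices down to `L`.
k^i*c^kki≤k^kki : ∀ c i → 0 < c →
  suc c ^ i * c ^ (suc c * suc c * i) ≤ suc c ^ (suc c * suc c * i)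
k^i*c^kki≤k^kki c i 0<c = ^-scale k c k (k * k) i
  (≤-trans (*-monoˡ-≤ (c ^ (k * k)) (<⇒≤ (n<2^n k))) (^-scale 2 c k k k (2*c^k≤k^k c 0<c)))
  where k = suc c

-- With E ≥ 2m and D = E², the factor D^t outweighs the product of (2m)^t ≤ E^t and
-- 2 (1 + D)^j < E^(4j + 2) ≤ E^t.
counting-contradiction : ∀ n m t j E L → 0 < n → 2 * m ≤ E → 2 ≤ E → 4 * j + 2 ≤ t →
  L * (E * E) ≤ 2 * n → n ^ t ≤ 2 * (suc (E * E) ^ j * L ^ t) * m ^ t → ⊥
counting-contradiction n m t j E L 0<n 2m≤E 2≤E j≤t LD≤ le = <-irrefl refl (begin-strict
  n ^ t * (D ^ t)
    ≤⟨ *-monoˡ-≤ (D ^ t) le ⟩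
  2 * (suc D ^ j * L ^ t) * m ^ t * D ^ t
    ≡⟨ regroup (suc D ^ j) (L ^ t) (m ^ t) (D ^ t) ⟩
  2 * suc D ^ j * (L ^ t * D ^ t) * m ^ t
    ≡⟨ cong (λ z → 2 * suc D ^ j * z * m ^ t) (^-distribʳ-* t L D) ⟨
  2 * suc D ^ j * (L * D) ^ t * m ^ t
    ≤⟨ *-monoˡ-≤ (m ^ t) (*-monoʳ-≤ (2 * suc D ^ j) (^-monoˡ-≤ t LD≤)) ⟩
  2 * suc D ^ j * (2 * n) ^ t * m ^ t
    ≡⟨ cong (λ z → 2 * suc D ^ j * z * m ^ t) (^-distribʳ-* t 2 n) ⟩
  2 * suc D ^ j * (2 ^ t * n ^ t) * m ^ t
    ≡⟨ regroup′ (2 * suc D ^ j) (2 ^ t) (n ^ t) (m ^ t) ⟩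
  n ^ t * (2 * suc D ^ j * (2 ^ t * m ^ t))
    ≡⟨ cong (λ z → n ^ t * (2 * suc D ^ j * z)) (^-distribʳ-* t 2 m) ⟨
  n ^ t * (2 * suc D ^ j * (2 * m) ^ t)
    ≤⟨ *-monoʳ-≤ (n ^ t) (*-monoʳ-≤ (2 * suc D ^ j) (^-monoˡ-≤ t 2m≤E)) ⟩
  n ^ t * (2 * suc D ^ j * E ^ t)
    <⟨ *-monoʳ-< (n ^ t) {{n^t≢0}} (*-monoˡ-< (E ^ t) {{E^t≢0}} 2*[1+D]^j<) ⟩
  n ^ t * (E ^ t * E ^ t)
    ≡⟨ cong (n ^ t *_) (^-distribʳ-* t E E) ⟨
  n ^ t * (D ^ t) ∎)
  where
  open ≤-Reasoning
  D = E * E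
  instance
    E≢0 : NonZero E
    E≢0 = >-nonZero (≤-trans (s≤s z≤n) 2≤E)
  n^t≢0 = m^n≢0 n t {{>-nonZero 0<n}}
  E^t≢0 = m^n≢0 E t
  regroup : ∀ a l m d → 2 * (a * l) * m * d ≡ 2 * a * (l * d) * m
  regroup = solve-∀
  regroup′ : ∀ a b n m → a * (b * n) * m ≡ n * (a * (b * m))
  regroup′ = solve-∀
  4≤D : 4 ≤ D
  4≤D = *-mono-≤ 2≤E 2≤E
  1+D≤ : suc D ≤ E ^ 4
  1+D≤ = begin
    suc D      ≤⟨ +-monoˡ-≤ D (≤-trans (s≤s z≤n) 4≤D) ⟩
    D + D      ≡⟨ cong (D +_) (+-identityʳ D) ⟨
    2 * D      ≤⟨ *-monoˡ-≤ D (≤-trans (s≤s (s≤s z≤n)) 4≤D) ⟩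
    D * D      ≡⟨ square E ⟩
    E ^ 4      ∎
    where
    square : ∀ e → e * e * (e * e) ≡ e * (e * (e * (e * 1)))
    square = solve-∀
  2*[1+D]^j< : 2 * suc D ^ j < E ^ t
  2*[1+D]^j< = begin-strict
    2 * suc D ^ j          ≤⟨ *-monoʳ-≤ 2 (^-monoˡ-≤ j 1+D≤) ⟩
    2 * (E ^ 4) ^ j        ≡⟨ cong (2 *_) (^-*-assoc E 4 j) ⟩
    2 * E ^ (4 * j)        <⟨ *-monoˡ-< (E ^ (4 * j)) {{m^n≢0 E (4 * j)}}
                                (≤-trans (s≤s (s≤s (s≤s z≤n))) 4≤D) ⟩
    E * E * E ^ (4 * j)    ≡⟨ *-assoc E E _ ⟩
    E ^ (2 + 4 * j)        ≤⟨ ^-monoʳ-≤ E (≤-trans (≤-reflexive (+-comm 2 (4 * j))) j≤t) ⟩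
    E ^ t                  ∎

-- r = 2 + 52 q makes k ^ r outgrow the threshold 4j + 2 of the counting argument.
exponent-choice : ∀ k q → 2 ≤ k → 0 < q →
  4 * (k * k * (2 * suc ((2 + 52 * q) * q))) + 2 ≤ k ^ (2 + 52 * q)
exponent-choice k q 2≤k 0<q = begin
  4 * (k * k * (2 * suc ((2 + 52 * q) * q))) + 2
    ≤⟨ +-monoʳ-≤ (4 * (k * k * (2 * suc ((2 + 52 * q) * q))))
         (*-monoʳ-≤ 2 (*-mono-≤ 1≤k 1≤k)) ⟩
  4 * (k * k * (2 * suc ((2 + 52 * q) * q))) + 2 * (k * k)
    ≡⟨ regroup k q ⟩
  k * k * (10 * 1 + 16 * q + 416 * q * q)
    ≤⟨ *-monoʳ-≤ (k * k) (+-monoˡ-≤ (416 * q * q) (+-monoˡ-≤ (16 * q) (*-monoʳ-≤ 10 0<q))) ⟩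
  k * k * (10 * q + 16 * q + 416 * q * q)
    -- The added terms complete the square of `suc (26 * q)`, which is at most `2 ^ (26 * q)`. Hence
    -- `52 = 2 * 26`, while the summand `2` of the exponent pays for `k * k`.
    ≤⟨ *-monoʳ-≤ (k * k) (m≤m+n _ (1 + 26 * q + 260 * q * q)) ⟩
  k * k * (10 * q + 16 * q + 416 * q * q + (1 + 26 * q + 260 * q * q))
    ≡⟨ cong (k * k *_) (factor q) ⟩
  k * k * (suc (26 * q) * suc (26 * q))
    ≤⟨ *-monoʳ-≤ (k * k) (*-mono-≤ (n<2^n (26 * q)) (n<2^n (26 * q))) ⟩
  k * k * (2 ^ (26 * q) * 2 ^ (26 * q))
    ≡⟨ cong (k * k *_) (^-distribˡ-+-* 2 (26 * q) (26 * q)) ⟨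
  k * k * 2 ^ (26 * q + 26 * q)
    ≡⟨ cong (λ z → k * k * 2 ^ z) (double q) ⟩
  k * k * 2 ^ (52 * q)
    ≤⟨ *-monoʳ-≤ (k * k) (^-monoˡ-≤ (52 * q) 2≤k) ⟩
  k * k * k ^ (52 * q)
    ≡⟨ *-assoc k k _ ⟩
  k ^ (2 + 52 * q) ∎
  where
  open ≤-Reasoning
  1≤k : 1 ≤ k
  1≤k = ≤-trans (s≤s z≤n) 2≤k
  regroup : ∀ k q → 4 * (k * k * (2 * suc ((2 + 52 * q) * q))) + 2 * (k * k) ≡
    k * k * (10 * 1 + 16 * q + 416 * q * q)
  regroup = solve-∀
  factor : ∀ q → 10 * q + 16 * q + 416 * q * q + (1 + 26 * q + 260 * q * q) ≡
    suc (26 * q) * suc (26 * q)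
  factor = solve-∀
  double : ∀ q → 26 * q + 26 * q ≡ 52 * q
  double = solve-∀

-- The clique bound, applied to `R` and to `R′` with their roles exchanged, makes homogeneous
-- `k ^ r`-sets so rare that thinning to `(k ^ r) ^ q` vertices would leave fewer than one, against
-- the penultimate hypothesis.
not-everywhere-dense : {A : Set} (R R′ : BoolRel A) → Sym R → Sym R′ → Complementary R R′ →
  ∀ c q r (V : List A) → 0 < c → let k = suc c; e = 2 * suc (r * q) in
  4 * (k * k * e) + 2 ≤ k ^ r → k ^ e < length V →
  (∀ ys → ys ⊆ V → length ys ≡ (k ^ r) ^ q → 0 < cliques R (k ^ r) ys + cliques R′ (k ^ r) ys) →
  (∀ xs → xs ⊆ V → length V ≤ k ^ e * length xs →
    length xs C 2 < k * cliques R 2 xs × length xs C 2 < k * cliques R′ 2 xs) → ⊥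
not-everywhere-dense {A} R R′ R-sym R′-sym R′≡ c q r V 0<c large D<n hom dense
  with sparsify {t = suc c ^ r} {λ xs → cliques R (suc c ^ r) xs + cliques R′ (suc c ^ r) xs}
         (Counts-+ {t = suc c ^ r} (cliques-counts R (suc c ^ r)) (cliques-counts R′ (suc c ^ r)))
         ((suc c ^ r) ^ q) V m≤n
  where
  open ≤-Reasoning
  k = suc c
  m≤n : (k ^ r) ^ q ≤ length V
  m≤n = begin
    (k ^ r) ^ q            ≡⟨ ^-*-assoc k r q ⟩
    k ^ (r * q)            ≤⟨ ^-monoʳ-≤ k (≤-trans (n≤1+n (r * q)) (m≤m+n (suc (r * q)) _)) ⟩
    k ^ (2 * suc (r * q))  ≤⟨ <⇒≤ D<n ⟩
    length V                          ∎
... | ys , s , ℓ , le = counting-contradiction n m t j E L (≤-trans (s≤s z≤n) D<n) 2m≤E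
  (≤-trans (*-monoʳ-≤ 2 (m^n>0 k (r * q))) (≤-trans (≤-reflexive (cong (2 *_) (sym m≡))) 2m≤E))
  large L*D≤2n (begin
    n ^ t
      ≤⟨ m≤n*m (n ^ t) (h ys) {{>-nonZero (hom ys s ℓ)}} ⟩
    h ys * n ^ t
      ≤⟨ le ⟩
    h V * m ^ t
      ≤⟨ *-monoˡ-≤ (m ^ t) (+-mono-≤ (bound R R′ R-sym R′-sym R′≡ (λ xs s′ → proj₂ ∘ dense xs s′))
           (bound R′ R R′-sym R-sym R≡ (λ xs s′ → proj₁ ∘ dense xs s′))) ⟩
    (B + B) * m ^ t
      ≡⟨ cong (λ z → (B + z) * m ^ t) (+-identityʳ B) ⟨
    2 * B * m ^ t ∎)
  where
  open ≤-Reasoning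
  k = suc c
  t = k ^ r
  m = t ^ q
  -- One factor `k ≥ 2` more than `m = k ^ (r * q)`, which yields `2 * m ≤ E`; `e` is the exponent
  -- of `E * E` as a power of `k`.
  E = k ^ suc (r * q)
  D = E * E
  e = 2 * suc (r * q)
  j = k * k * e
  n = length V
  h : List A → ℕ
  h xs = cliques R t xs + cliques R′ t xs
  instance
    D≢0 : NonZero D
    D≢0 = m*n≢0 E E {{m^n≢0 k (suc (r * q))}} {{m^n≢0 k (suc (r * q))}}
  -- Rounding up ensures `n ≤ D * L`; because `D < n`, it still keeps `L * D ≤ 2 * n`.
  L = suc (n / D)
  B = suc D ^ j * L ^ t
  D≡ : D ≡ k ^ e
  D≡ = ≡.trans (sym (^-distribˡ-+-* k (suc (r * q)) (suc (r * q))))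
    (cong (λ z → k ^ (suc (r * q) + z)) (sym (+-identityʳ _)))
  m≡ : m ≡ k ^ (r * q)
  m≡ = ^-*-assoc k r q
  2m≤E : 2 * m ≤ E
  2m≤E = *-mono-≤ (s≤s 0<c) (≤-reflexive m≡)
  L*D≤2n : L * D ≤ 2 * n
  L*D≤2n = begin
    D + n / D * D    ≤⟨ +-mono-≤ (≤-trans (≤-reflexive D≡) (<⇒≤ D<n)) (m/n*n≤m n D) ⟩
    n + n            ≡⟨ cong (n +_) (+-identityʳ n) ⟨
    2 * n            ∎
  n≤D*L : n ≤ D * L
  n≤D*L = begin
    n                      ≡⟨ m≡m%n+[m/n]*n n D ⟩
    n % D + n / D * D      ≤⟨ +-monoˡ-≤ (n / D * D) (<⇒≤ (m%n<n n D)) ⟩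
    L * D                  ≡⟨ *-comm L D ⟩
    D * L                  ∎
  level : n * c ^ j ≤ L * k ^ j
  level = begin
    n * c ^ j             ≤⟨ *-monoˡ-≤ (c ^ j) n≤D*L ⟩
    D * L * c ^ j         ≡⟨ cong (λ z → z * L * c ^ j) D≡ ⟩
    k ^ e * L * c ^ j     ≡⟨ exchange (k ^ e) L (c ^ j) ⟩
    L * (k ^ e * c ^ j)   ≤⟨ *-monoʳ-≤ L (k^i*c^kki≤k^kki c e 0<c) ⟩
    L * k ^ j             ∎
    where
    exchange : ∀ a b c → a * b * c ≡ b * (a * c)
    exchange = solve-∀
  R≡ : Complementary R′ R
  R≡ x y = ≡.trans (sym (not-involutive (R x y))) (cong not (sym (R′≡ x y)))
  bound : (R R′ : BoolRel A) → Sym R → Sym R′ → Complementary R R′ →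
    (∀ xs → xs ⊆ V → n ≤ k ^ e * length xs → length xs C 2 < k * cliques R′ 2 xs) →
    cliques R t V ≤ B
  bound R R′ R-sym R′-sym R′≡ dense = cliques-bound R R′ R-sym R′-sym R′≡ c D L V n≤D*L
    (λ xs s′ L<ℓ → dense xs s′ (≤-trans n≤D*L
      (≤-trans (*-monoʳ-≤ D (<⇒≤ L<ℓ)) (≤-reflexive (cong (_* length xs) D≡)))))
    j t V ⊆-refl level

-- Vertex subsets as lists

-- The labelling `f` is a parameter so that inductions over the subset can pass to `f ∘ suc`; for
-- vertex sets of a graph it is `id`.
select : {A : Set} {n : ℕ} → Subset n → (Fin n → A) → List A
select []          f = []
select (true ∷ S)  f = f zero ∷ select S (f ∘ suc)
select (false ∷ S) f = select S (f ∘ suc)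

length-select : {A : Set} {n : ℕ} (S : Subset n) (f : Fin n → A) → length (select S f) ≡ ∣ S ∣
length-select []          f = refl
length-select (true ∷ S)  f = cong suc (length-select S (f ∘ suc))
length-select (false ∷ S) f = length-select S (f ∘ suc)

select-⊆ : {A : Set} {n : ℕ} (S : Subset n) (f : Fin n → A) → select S f ⊆ tabulate f
select-⊆ []          f = []
select-⊆ (true ∷ S)  f = refl ∷ select-⊆ S (f ∘ suc)
select-⊆ (false ∷ S) f = f zero ∷ʳ select-⊆ S (f ∘ suc)

⊆⇒select : {A : Set} {n : ℕ} (f : Fin n → A) {xs : List A} → xs ⊆ tabulate f →
  ∃ λ S → select S f ≡ xs
⊆⇒select {n = zero}  f [] = [] , refl
⊆⇒select {n = suc n} f (_ ∷ʳ s) with ⊆⇒select (f ∘ suc) s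
... | S , eq = false ∷ S , eq
⊆⇒select {n = suc n} f (refl ∷ s) with ⊆⇒select (f ∘ suc) s
... | S , eq = true ∷ S , cong (f zero ∷_) eq

All-select : {A : Set} {n : ℕ} {P : A → Set} (S : Subset n) (f : Fin n → A) →
  (∀ i → lookup S i ≡ true → P (f i)) → All P (select S f)
All-select []          f Pf = []
All-select (true ∷ S)  f Pf = Pf zero refl ∷ All-select S (f ∘ suc) (Pf ∘ suc)
All-select (false ∷ S) f Pf = All-select S (f ∘ suc) (Pf ∘ suc)

AllPairs-select : {A : Set} {n : ℕ} {P : A → A → Set} (S : Subset n) (f : Fin n → A) →
  (∀ i j → lookup S i ≡ true → lookup S j ≡ true → toℕ i < toℕ j → P (f i) (f j)) →
  AllPairs P (select S f)
AllPairs-select []          f Pf = []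
AllPairs-select (true ∷ S)  f Pf =
  All-select S (f ∘ suc) (λ j j∈S → Pf zero (suc j) refl j∈S (s≤s z≤n)) ∷
  AllPairs-select S (f ∘ suc) (λ i j i∈S j∈S i<j → Pf (suc i) (suc j) i∈S j∈S (s≤s i<j))
AllPairs-select (false ∷ S) f Pf =
  AllPairs-select S (f ∘ suc) (λ i j i∈S j∈S i<j → Pf (suc i) (suc j) i∈S j∈S (s≤s i<j))

indicator : Bool → ℕ
indicator b = if b then 1 else 0

sum-map-pairs : ∀ {n} (g : Fin n × Fin n → ℕ) xs →
  sum (map g (pairs n xs)) ≡ sum (map (λ i → sum (tabulate (λ j → g (i , j)))) xs)
sum-map-pairs g [] = refl
sum-map-pairs {n} g (i ∷ xs) = begin
  sum (map g (map (i ,_) (allFin n) List.++ pairs n xs))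
    ≡⟨ cong sum (map-++ g (map (i ,_) (allFin n)) (pairs n xs)) ⟩
  sum (map g (map (i ,_) (allFin n)) List.++ map g (pairs n xs))
    ≡⟨ sum-++ (map g (map (i ,_) (allFin n))) _ ⟩
  sum (map g (map (i ,_) (allFin n))) + sum (map g (pairs n xs))
    ≡⟨ cong₂ _+_ (cong sum (≡.trans (sym (map-∘ (allFin n))) (map-tabulate id (λ j → g (i , j)))))
         (sum-map-pairs g xs) ⟩
  sum (tabulate (λ j → g (i , j))) + sum (map (λ i → sum (tabulate (λ j → g (i , j)))) xs) ∎
  where open ≡-Reasoning

sum-tabulate-0 : ∀ {n} (g : Fin n → ℕ) → (∀ i → g i ≡ 0) → sum (tabulate g) ≡ 0
sum-tabulate-0 {zero}  g g≡0 = refl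
sum-tabulate-0 {suc n} g g≡0 = cong₂ _+_ (g≡0 zero) (sum-tabulate-0 (g ∘ suc) (g≡0 ∘ suc))

sum-tabulate≡0 : ∀ {n} (g : Fin n → ℕ) → sum (tabulate g) ≡ 0 → ∀ i → g i ≡ 0
sum-tabulate≡0 {suc n} g eq zero    = m+n≡0⇒m≡0 (g zero) eq
sum-tabulate≡0 {suc n} g eq (suc i) = sum-tabulate≡0 (g ∘ suc) (m+n≡0⇒n≡0 (g zero) eq) i

edgeIndicator : {A : Set} {n : ℕ} → BoolRel A → Subset n → (Fin n → A) → Fin n → Fin n → ℕ
edgeIndicator R S f i j =
  indicator (lookup S i ∧ lookup S j ∧ ⌊ toℕ i <? toℕ j ⌋ ∧ R (f i) (f j))

edgeSum : {A : Set} {n : ℕ} → BoolRel A → Subset n → (Fin n → A) → ℕ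
edgeSum R S f = sum (tabulate λ i → sum (tabulate λ j → edgeIndicator R S f i j))

edgesIn≡edgeSum : ∀ {n} (G : Graph n) S → edgesIn G S ≡ edgeSum (adj G) S id
edgesIn≡edgeSum {n} G S = ≡.trans
  (sum-map-pairs (λ (i , j) → edgeIndicator (adj G) S id i j) (allFin n))
  (cong sum (map-tabulate id (λ i → sum (tabulate (edgeIndicator (adj G) S id i)))))

sum-row : {A : Set} {n : ℕ} (p : A → Bool) (S : Subset n) (f : Fin n → A) →
  sum (tabulate λ j → indicator (lookup S j ∧ p (f j))) ≡ length (filterᵇ p (select S f))
sum-row p [] f = refl
sum-row p (false ∷ S) f = sum-row p S (f ∘ suc)
sum-row p (true ∷ S) f with p (f zero)
... | true  = cong suc (sum-row p S (f ∘ suc))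
... | false = sum-row p S (f ∘ suc)

⌊suc<?suc⌋ : ∀ a b → ⌊ suc a <? suc b ⌋ ≡ ⌊ a <? b ⌋
⌊suc<?suc⌋ a b = ≡.trans (isYes≗does (suc a <? suc b)) (sym (isYes≗does (a <? b)))

edgeSum-tail : {A : Set} {n : ℕ} (R : BoolRel A) (b : Bool) (S : Subset n) (f : Fin (suc n) → A) →
  sum (tabulate λ i → sum (tabulate λ j → edgeIndicator R (b ∷ S) f (suc i) j)) ≡
  edgeSum R S (f ∘ suc)
edgeSum-tail R b S f = cong sum (tabulate-cong λ i → cong₂ _+_
  (cong indicator (≡.trans (cong (lookup S i ∧_) (∧-zeroʳ b)) (∧-zeroʳ (lookup S i))))
  (cong sum (tabulate-cong λ j →
    cong (λ c → indicator (lookup S i ∧ lookup S j ∧ c ∧ R (f (suc i)) (f (suc j))))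
      (⌊suc<?suc⌋ (toℕ i) (toℕ j)))))

-- Row `zero` counts the selected neighbours of the head, if the head is selected. In the other rows
-- the test `toℕ i < toℕ j` kills column `zero`, and what remains is the sum for the tail.
edgeSum≡cliques₂ : {A : Set} {n : ℕ} (R : BoolRel A) (S : Subset n) (f : Fin n → A) →
  edgeSum R S f ≡ cliques R 2 (select S f)
edgeSum≡cliques₂ R [] f = refl
edgeSum≡cliques₂ {n = suc n} R (false ∷ S) f = cong₂ _+_
  (sum-tabulate-0 {suc n} (λ j → edgeIndicator R (false ∷ S) f zero j) (λ _ → refl))
  (≡.trans (edgeSum-tail R false S f) (edgeSum≡cliques₂ R S (f ∘ suc)))
edgeSum≡cliques₂ R (true ∷ S) f = ≡.trans
  (+-comm (sum (tabulate (edgeIndicator R (true ∷ S) f zero))) _)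
  (cong₂ _+_ (≡.trans (edgeSum-tail R true S f) (edgeSum≡cliques₂ R S (f ∘ suc)))
    (≡.trans (sum-row (R (f zero)) S (f ∘ suc))
      (sym (cliques₁ R (filterᵇ (R (f zero)) (select S (f ∘ suc)))))))

edgesIn≡cliques₂ : ∀ {n} (G : Graph n) S → edgesIn G S ≡ cliques (adj G) 2 (select S id)
edgesIn≡cliques₂ G S = ≡.trans (edgesIn≡edgeSum G S) (edgeSum≡cliques₂ (adj G) S id)

cliques₂≡0⇒unrelated : ∀ {n} (R : BoolRel (Fin n)) S → cliques R 2 (select S id) ≡ 0 → ∀ i j →
  lookup S i ≡ true → lookup S j ≡ true → toℕ i < toℕ j → R i j ≡ false
cliques₂≡0⇒unrelated R S eq i j i∈S j∈S i<j
  with sum-tabulate≡0 _ (sum-tabulate≡0 _ (≡.trans (edgeSum≡cliques₂ R S id) eq) i) j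
... | zero-entry rewrite i∈S | j∈S with toℕ i <? toℕ j | R i j
...   | yes _ | false = refl
...   | no ≮  | _     = contradiction i<j ≮

-- The Boolean tests, `hom` and the clique counts

all-intro : {A : Set} (p : A → Bool) → (∀ x → p x ≡ true) → ∀ xs → all p xs ≡ true
all-intro p p≡ [] = refl
all-intro p p≡ (x ∷ xs) rewrite p≡ x = all-intro p p≡ xs

all-elim : {A : Set} (p : A → Bool) {xs : List A} → all p xs ≡ true → ∀ {x} → x ∈ xs → p x ≡ true
all-elim p {x ∷ xs} eq x∈ with p x in px
all-elim p eq (here refl) | true = px
all-elim p eq (there x∈)  | true = all-elim p eq x∈

∈-pairs : ∀ {n} (i j : Fin n) → (i , j) ∈ pairs n (allFin n)
∈-pairs {n} i j = ∈-concatMap⁺ (λ i → map (i ,_) (allFin n))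
  (lose (∈-allFin i) (∈-map⁺ (i ,_) (∈-allFin j)))

nonAdj : ∀ {n} → Graph n → BoolRel (Fin n)
nonAdj G i j = not (adj G i j)

nonAdj-sym : ∀ {n} (G : Graph n) → Sym (nonAdj G)
nonAdj-sym G i j = cong not (Graph.sym G i j)

-- isClique and isIndep are the cases of this test for adj and for non-adjacency.
isHomogeneous : ∀ {n} → BoolRel (Fin n) → Subset n → Bool
isHomogeneous {n} R S = all (λ p → let i = proj₁ p ; j = proj₂ p in
  not (i ∈ᵇ S ∧ j ∈ᵇ S ∧ not ⌊ i Fin.≟ j ⌋) ∨ R i j) (pairs n (allFin n))

isHomogeneous-intro : ∀ {n} (R : BoolRel (Fin n)) → Sym R → ∀ S →
  (∀ i j → lookup S i ≡ true → lookup S j ≡ true → toℕ i < toℕ j → R i j ≡ true) →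
  isHomogeneous R S ≡ true
isHomogeneous-intro {n} R R-sym S related = all-intro _ test (pairs n (allFin n))
  where
  test : ∀ p → not (proj₁ p ∈ᵇ S ∧ proj₂ p ∈ᵇ S ∧ not ⌊ proj₁ p Fin.≟ proj₂ p ⌋) ∨
    R (proj₁ p) (proj₂ p) ≡ true
  test (i , j) with lookup S i in i∈S | lookup S j in j∈S | i Fin.≟ j
  ... | false | _     | _     = refl
  ... | true  | false | _     = refl
  ... | true  | true  | yes _ = refl
  ... | true  | true  | no i≢j with <-cmp (toℕ i) (toℕ j)
  ...   | tri< i<j _ _ = related i j i∈S j∈S i<j
  ...   | tri≈ _ i≡j _ = contradiction (toℕ-injective i≡j) i≢j
  ...   | tri> _ _ j<i = ≡.trans (R-sym i j) (related j i j∈S i∈S j<i)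

isHomogeneous-elim : ∀ {n} (R : BoolRel (Fin n)) S → isHomogeneous R S ≡ true → ∀ i j →
  lookup S i ≡ true → lookup S j ≡ true → toℕ i < toℕ j → R i j ≡ true
isHomogeneous-elim R S hS i j i∈S j∈S i<j with all-elim _ hS (∈-pairs i j)
... | test rewrite i∈S | j∈S with i Fin.≟ j
...   | yes refl = contradiction i<j (<-irrefl refl)
...   | no _     = test

≤-foldr-⊔ : {A : Set} (g : A → ℕ) {xs : List A} {x : A} → x ∈ xs → g x ≤ foldr _⊔_ 0 (map g xs)
≤-foldr-⊔ g (here refl) = m≤m⊔n _ _
≤-foldr-⊔ g (there x∈) = ≤-trans (≤-foldr-⊔ g x∈) (m≤n⊔m _ _)

foldr-⊔-witness : {A : Set} (g : A → ℕ) (xs : List A) {t : ℕ} → 0 < t →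
  t ≤ foldr _⊔_ 0 (map g xs) → ∃ λ x → t ≤ g x
foldr-⊔-witness g [] 0<t t≤ = contradiction (≤-trans 0<t t≤) λ ()
foldr-⊔-witness g (x ∷ xs) 0<t t≤ with ⊔-sel (g x) (foldr _⊔_ 0 (map g xs))
... | inj₁ eq = x , ≤-trans t≤ (≤-reflexive eq)
... | inj₂ eq = foldr-⊔-witness g xs 0<t (≤-trans t≤ (≤-reflexive eq))

∈-allSubsets : ∀ {n} (S : Subset n) → S ∈ allSubsets n
∈-allSubsets [] = here refl
∈-allSubsets (true ∷ S) = ∈-++⁺ˡ (∈-map⁺ (true ∷_) (∈-allSubsets S))
∈-allSubsets {suc n} (false ∷ S) =
  ∈-++⁺ʳ (map (true ∷_) (allSubsets n)) (∈-map⁺ (false ∷_) (∈-allSubsets S))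

homSize : ∀ {n} → Graph n → Subset n → ℕ
homSize G S = if isClique G S ∨ isIndep G S then ∣ S ∣ else 0

clique≤hom : ∀ {n} (G : Graph n) S → isClique G S ≡ true → ∣ S ∣ ≤ hom G
clique≤hom G S clique = ≤-trans
  (≤-reflexive (cong (λ b → if b ∨ isIndep G S then ∣ S ∣ else 0) (sym clique)))
  (≤-foldr-⊔ (homSize G) (∈-allSubsets S))

indep≤hom : ∀ {n} (G : Graph n) S → isIndep G S ≡ true → ∣ S ∣ ≤ hom G
indep≤hom G S indep =
  ≤-trans (≤-reflexive (sym value)) (≤-foldr-⊔ (homSize G) (∈-allSubsets S))
  where
  value : homSize G S ≡ ∣ S ∣
  value with isClique G S
  ... | true = refl
  ... | false rewrite indep = refl

no-edges⇒length≤hom : ∀ {n} (G : Graph n) {xs} → xs ⊆ allFin n →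
  cliques (adj G) 2 xs ≡ 0 → length xs ≤ hom G
no-edges⇒length≤hom G s eq with ⊆⇒select id s
... | S , refl = ≤-trans (≤-reflexive (length-select S id)) (indep≤hom G S
  (isHomogeneous-intro (nonAdj G) (nonAdj-sym G) S
    λ i j i∈S j∈S i<j → cong not (cliques₂≡0⇒unrelated (adj G) S eq i j i∈S j∈S i<j)))

no-nonedges⇒length≤hom : ∀ {n} (G : Graph n) {xs} → xs ⊆ allFin n →
  cliques (nonAdj G) 2 xs ≡ 0 → length xs ≤ hom G
no-nonedges⇒length≤hom G s eq with ⊆⇒select id s
... | S , refl = ≤-trans (≤-reflexive (length-select S id)) (clique≤hom G S
  (isHomogeneous-intro (adj G) (Graph.sym G) S
    λ i j i∈S j∈S i<j → not-injective (cliques₂≡0⇒unrelated (nonAdj G) S eq i j i∈S j∈S i<j)))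

isHomogeneous⇒cliques>0 : ∀ {n} (R : BoolRel (Fin n)) S → isHomogeneous R S ≡ true →
  ∀ t → t ≤ ∣ S ∣ → 0 < cliques R t (allFin n)
isHomogeneous⇒cliques>0 {n} R S hS t t≤ = ≤-trans
  (AllPairs⇒cliques>0 R t (AllPairs-select S id (isHomogeneous-elim R S hS))
    (≤-trans t≤ (≤-reflexive (sym (length-select S id)))))
  (cliques-mono-⊆ R t (select-⊆ S id))

hom⇒cliques>0 : ∀ {n} (G : Graph n) t → t ≤ hom G →
  0 < cliques (adj G) t (allFin n) + cliques (nonAdj G) t (allFin n)
-- Treated apart because a lower bound of `0` may be met by the default value of the fold, which
-- yields no witness.
hom⇒cliques>0 G zero t≤ = s≤s z≤n
hom⇒cliques>0 {n} G (suc t) t≤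
  with foldr-⊔-witness (homSize G) (allSubsets n) (s≤s z≤n) t≤
... | S , t≤S with isClique G S in clique | isIndep G S in indep
...   | true  | _    = m≤n⇒m≤n+o _ (isHomogeneous⇒cliques>0 (adj G) S clique (suc t) t≤S)
...   | false | true = m≤n⇒m≤o+n (cliques (adj G) (suc t) (allFin n))
                         (isHomogeneous⇒cliques>0 (nonAdj G) S indep (suc t) t≤S)

Unique-⊆ : {A : Set} {xs ys : List A} → xs ⊆ ys → Unique ys → Unique xs
Unique-⊆ [] [] = []
Unique-⊆ (_ ∷ʳ s) (_ ∷ u) = Unique-⊆ s u
Unique-⊆ (refl ∷ s) (p ∷ u) = All-resp-⊆ s p ∷ Unique-⊆ s u

Unique⇒lookup-injective : {A : Set} {xs : List A} → Unique xs → Injective _≡_ _≡_ (List.lookup xs)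
Unique⇒lookup-injective (p ∷ u) {zero}  {zero}  eq = refl
Unique⇒lookup-injective (p ∷ u) {zero}  {suc j} eq = contradiction eq (All.lookup p (∈-lookup j))
Unique⇒lookup-injective (p ∷ u) {suc i} {zero}  eq = contradiction (sym eq) (All.lookup p (∈-lookup i))
Unique⇒lookup-injective (p ∷ u) {suc i} {suc j} eq = cong suc (Unique⇒lookup-injective u eq)

-- On `t ^ q` vertices, `hom ^ q ≥ (t ^ q) ^ p ≥ t ^ q` forces `hom ≥ t`. Heredity allows this for
-- the subgraph induced on `xs`, indexed through `List.lookup`, and the count is carried back along
-- that indexing.
ErdosHajnal⇒cliques>0 : (F : Family) → Hereditary F → ∀ p q → 0 < p → 0 < q →
  (∀ n (G : Graph n) → F n G → n ^ p ≤ hom G ^ q) →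
  ∀ {n} (G : Graph n) → F n G → ∀ t .{{_ : NonZero t}} xs → xs ⊆ allFin n → length xs ≡ t ^ q →
  0 < cliques (adj G) t xs + cliques (nonAdj G) t xs
ErdosHajnal⇒cliques>0 F hereditary p q 0<p 0<q eh {n} G G∈F t xs s ℓ =
  subst (0 <_) (cong₂ _+_ (restrict (adj G)) (restrict (nonAdj G)))
    (hom⇒cliques>0 G′ t (≮⇒≥ λ hom<t → <⇒≱ (^-monoˡ-< q {{>-nonZero 0<q}} hom<t) (begin
      t ^ q          ≡⟨ ℓ ⟨
      ℓxs            ≡⟨ ^-identityʳ ℓxs ⟨
      ℓxs ^ 1        ≤⟨ ^-monoʳ-≤ ℓxs {{subst NonZero (sym ℓ) (m^n≢0 t q)}} 0<p ⟩
      ℓxs ^ p        ≤⟨ eh ℓxs G′ (hereditary G (List.lookup xs) lookup-inj G∈F) ⟩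
      hom G′ ^ q     ∎)))
  where
  open ≤-Reasoning
  ℓxs = length xs
  G′ = induced G (List.lookup xs)
  lookup-inj : Injective _≡_ _≡_ (List.lookup xs)
  lookup-inj = Unique⇒lookup-injective (Unique-⊆ s (allFin⁺ n))
  restrict : (R : BoolRel (Fin n)) →
    cliques (λ i j → R (List.lookup xs i) (List.lookup xs j)) t (allFin ℓxs) ≡ cliques R t xs
  restrict R = ≡.trans (cliques-map R (List.lookup xs) t (allFin ℓxs))
    (cong (cliques R t) (≡.trans (map-tabulate id (List.lookup xs)) (tabulate-lookup xs)))

-- Rational estimates

toℚᵘ-toℚ : ∀ n → toℚᵘ (toℚ n) ≃ mkℚᵘ (pos n) 0
toℚᵘ-toℚ n = ℚ.toℚᵘ-fromℚᵘ (mkℚᵘ (pos n) 0)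

toℚ-mono-≤ : ∀ {m n} → m ≤ n → toℚ m ℚ.≤ toℚ n
toℚ-mono-≤ {m} {n} m≤n = ℚ.toℚᵘ-cancel-≤
  (ℚᵘ.≤-respʳ-≃ (ℚᵘ.≃-sym (toℚᵘ-toℚ n)) (ℚᵘ.≤-respˡ-≃ (ℚᵘ.≃-sym (toℚᵘ-toℚ m))
    (*≤* (ℤ.*-monoʳ-≤-nonNeg (pos 1) (ℤ.+≤+ m≤n)))))

toℚ-cancel-≤ : ∀ {m n} → toℚ m ℚ.≤ toℚ n → m ≤ n
toℚ-cancel-≤ {m} {n} le = ℤ.drop‿+≤+ (ℤ.*-cancelʳ-≤-pos (pos m) (pos n) (pos 1)
  (ℚᵘ.drop-*≤* (ℚᵘ.≤-respʳ-≃ (toℚᵘ-toℚ n) (ℚᵘ.≤-respˡ-≃ (toℚᵘ-toℚ m) (ℚ.toℚᵘ-mono-≤ le)))))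

toℚ-+ : ∀ m n → toℚ (m + n) ≡ toℚ m ℚ.+ toℚ n
toℚ-+ m n = ℚ.toℚᵘ-injective (begin
  toℚᵘ (toℚ (m + n))                 ≈⟨ toℚᵘ-toℚ (m + n) ⟩
  mkℚᵘ (pos (m + n)) 0                 ≈⟨ *≡* (cong (ℤ._* pos 1)
                                              (cong₂ ℤ._+_ (sym (ℤ.*-identityʳ (pos m)))
                                                           (sym (ℤ.*-identityʳ (pos n))))) ⟩
  mkℚᵘ (pos m) 0 ℚᵘ.+ mkℚᵘ (pos n) 0       ≈⟨ ℚᵘ.+-cong (toℚᵘ-toℚ m) (toℚᵘ-toℚ n) ⟨
  toℚᵘ (toℚ m) ℚᵘ.+ toℚᵘ (toℚ n)       ≈⟨ ℚ.toℚᵘ-homo-+ (toℚ m) (toℚ n) ⟨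
  toℚᵘ (toℚ m ℚ.+ toℚ n)               ∎)
  where open import Relation.Binary.Reasoning.Setoid ℚᵘ.≃-setoid

toℚ-* : ∀ m n → toℚ (m * n) ≡ toℚ m ℚ.* toℚ n
toℚ-* m n = ℚ.toℚᵘ-injective (begin
  toℚᵘ (toℚ (m * n))                 ≈⟨ toℚᵘ-toℚ (m * n) ⟩
  mkℚᵘ (pos (m * n)) 0                 ≈⟨ *≡* (cong (ℤ._* pos 1) (ℤ.pos-* m n)) ⟩
  mkℚᵘ (pos m) 0 ℚᵘ.* mkℚᵘ (pos n) 0       ≈⟨ ℚᵘ.*-cong (toℚᵘ-toℚ m) (toℚᵘ-toℚ n) ⟨
  toℚᵘ (toℚ m) ℚᵘ.* toℚᵘ (toℚ n)       ≈⟨ ℚ.toℚᵘ-homo-* (toℚ m) (toℚ n) ⟨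
  toℚᵘ (toℚ m ℚ.* toℚ n)               ∎)
  where open import Relation.Binary.Reasoning.Setoid ℚᵘ.≃-setoid

clear-denominator : ∀ {ε a c} → toℚᵘ ε ≃ mkℚᵘ (pos a) c → ε ℚ.* toℚ (suc c) ≡ toℚ a
clear-denominator {ε} {a} {c} eq = ℚ.toℚᵘ-injective (begin
  toℚᵘ (ε ℚ.* toℚ (suc c))                 ≈⟨ ℚ.toℚᵘ-homo-* ε (toℚ (suc c)) ⟩
  toℚᵘ ε ℚᵘ.* toℚᵘ (toℚ (suc c))           ≈⟨ ℚᵘ.*-cong eq (toℚᵘ-toℚ (suc c)) ⟩
  mkℚᵘ (pos a) c ℚᵘ.* mkℚᵘ (pos (suc c)) 0       ≈⟨ *≡* (≡.trans
                                                (ℤ.*-identityʳ (pos a ℤ.* pos (suc c)))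
                                                (cong (λ z → pos a ℤ.* pos z)
                                                  (sym (*-identityʳ (suc c))))) ⟩
  mkℚᵘ (pos a) 0                             ≈⟨ toℚᵘ-toℚ a ⟨
  toℚᵘ (toℚ a)                             ∎)
  where open import Relation.Binary.Reasoning.Setoid ℚᵘ.≃-setoid

toℚ-nonNeg : ∀ n → NonNegative (toℚ n)
toℚ-nonNeg n = nonNegative (toℚ-mono-≤ {0} {n} z≤n)

toℚ-pos : ∀ n → Positive (toℚ (suc n))
toℚ-pos n = positive (ℚ.<-≤-trans (ℚ.positive⁻¹ 1ℚ) (toℚ-mono-≤ {1} {suc n} (s≤s z≤n)))

≤ε* : ∀ {ε k} → 0ℚ ℚ.< ε → 1ℚ ℚ.≤ ε ℚ.* toℚ k → ∀ {x N} → k * x ≤ N → toℚ x ℚ.≤ ε ℚ.* toℚ N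
≤ε* {ε} {k} 0<ε 1≤εk {x} {N} kx≤N = begin
  toℚ x                        ≡⟨ ℚ.*-identityˡ (toℚ x) ⟨
  1ℚ ℚ.* toℚ x                 ≤⟨ ℚ.*-monoʳ-≤-nonNeg (toℚ x) {{toℚ-nonNeg x}} 1≤εk ⟩
  ε ℚ.* toℚ k ℚ.* toℚ x        ≡⟨ ℚ.*-assoc ε (toℚ k) (toℚ x) ⟩
  ε ℚ.* (toℚ k ℚ.* toℚ x)      ≡⟨ cong (ε ℚ.*_) (toℚ-* k x) ⟨
  ε ℚ.* toℚ (k * x)          ≤⟨ ℚ.*-monoˡ-≤-nonNeg ε {{nonNegative (ℚ.<⇒≤ 0<ε)}} (toℚ-mono-≤ kx≤N) ⟩
  ε ℚ.* toℚ N                  ∎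
  where open ℚ.≤-Reasoning

≤ε*⁻¹ : ∀ {ε k} → ε ℚ.* toℚ k ≡ 1ℚ → ∀ {x N} → toℚ x ℚ.≤ ε ℚ.* toℚ N → k * x ≤ N
≤ε*⁻¹ {ε} {k} εk≡1 {x} {N} le = toℚ-cancel-≤ (begin
  toℚ (k * x)                ≡⟨ toℚ-* k x ⟩
  toℚ k ℚ.* toℚ x              ≤⟨ ℚ.*-monoˡ-≤-nonNeg (toℚ k) {{toℚ-nonNeg k}} le ⟩
  toℚ k ℚ.* (ε ℚ.* toℚ N)      ≡⟨ ℚ.*-assoc (toℚ k) ε (toℚ N) ⟨
  toℚ k ℚ.* ε ℚ.* toℚ N        ≡⟨ cong (ℚ._* toℚ N) (≡.trans (ℚ.*-comm (toℚ k) ε) εk≡1) ⟩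
  1ℚ ℚ.* toℚ N                 ≡⟨ ℚ.*-identityˡ (toℚ N) ⟩
  toℚ N                        ∎)
  where open ℚ.≤-Reasoning

[1-ε]*≤ : ∀ {ε x y N} → x + y ≡ N → toℚ y ℚ.≤ ε ℚ.* toℚ N → (1ℚ ℚ.- ε) ℚ.* toℚ N ℚ.≤ toℚ x
[1-ε]*≤ {ε} {x} {y} {N} refl le = begin
  (1ℚ ℚ.- ε) ℚ.* toℚ N                 ≡⟨ solve 2 (λ e n → (con 1ℚ :- e) :* n := n :+ :- (e :* n))
                                            refl ε (toℚ N) ⟩
  toℚ N ℚ.+ ℚ.- (ε ℚ.* toℚ N)          ≤⟨ ℚ.+-monoʳ-≤ (toℚ N) (ℚ.neg-antimono-≤ le) ⟩
  toℚ N ℚ.+ ℚ.- toℚ y                  ≡⟨ cong (ℚ._+ ℚ.- toℚ y) (toℚ-+ x y) ⟩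
  toℚ x ℚ.+ toℚ y ℚ.+ ℚ.- toℚ y        ≡⟨ solve 2 (λ a b → a :+ b :+ :- b := a) refl (toℚ x) (toℚ y) ⟩
  toℚ x                                ∎
  where
  open ℚ.≤-Reasoning
  open +-*-Solver

[1-ε]*≤⁻¹ : ∀ {ε x y N} → x + y ≡ N → (1ℚ ℚ.- ε) ℚ.* toℚ N ℚ.≤ toℚ x → toℚ y ℚ.≤ ε ℚ.* toℚ N
[1-ε]*≤⁻¹ {ε} {x} {y} {N} refl le = begin
  toℚ y
    ≡⟨ solve 2 (λ a b → b := a :+ b :+ :- a) refl (toℚ x) (toℚ y) ⟩
  toℚ x ℚ.+ toℚ y ℚ.+ ℚ.- toℚ x
    ≡⟨ cong (ℚ._+ ℚ.- toℚ x) (toℚ-+ x y) ⟨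
  toℚ N ℚ.+ ℚ.- toℚ x
    ≤⟨ ℚ.+-monoʳ-≤ (toℚ N) (ℚ.neg-antimono-≤ le) ⟩
  toℚ N ℚ.+ ℚ.- ((1ℚ ℚ.- ε) ℚ.* toℚ N)
    ≡⟨ solve 2 (λ e n → n :+ :- ((con 1ℚ :- e) :* n) := e :* n) refl ε (toℚ N) ⟩
  ε ℚ.* toℚ N ∎
  where
  open ℚ.≤-Reasoning
  open +-*-Solver

-- Since `k` is at most `1 / ε²`, each factor `k` is paid for by two factors `ε`; this is the origin
-- of the Rödl exponent `e * 2`.
^ℚ*≤ : ∀ {ε k} → 0ℚ ℚ.< ε → ε ℚ.* ε ℚ.* toℚ k ℚ.≤ 1ℚ → ∀ e s →
  (ε ^ℚ (e * 2)) ℚ.* toℚ (k ^ e * s) ℚ.≤ toℚ s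
^ℚ*≤ {ε} {k} 0<ε εεk≤1 zero s = ℚ.≤-reflexive
  (≡.trans (ℚ.*-identityˡ _) (cong toℚ (+-identityʳ s)))
^ℚ*≤ {ε} {k} 0<ε εεk≤1 (suc e) s = begin
  ε ℚ.* (ε ℚ.* P) ℚ.* toℚ (k * k ^ e * s)
    ≡⟨ cong (ε ℚ.* (ε ℚ.* P) ℚ.*_) (≡.trans (cong toℚ (*-assoc k (k ^ e) s)) (toℚ-* k (k ^ e * s))) ⟩
  ε ℚ.* (ε ℚ.* P) ℚ.* (toℚ k ℚ.* X)
    ≡⟨ solve 4 (λ e p k x → e :* (e :* p) :* (k :* x) := p :* x :* (e :* e :* k)) refl ε P (toℚ k) X ⟩
  P ℚ.* X ℚ.* (ε ℚ.* ε ℚ.* toℚ k)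
    ≤⟨ ℚ.*-monoʳ-≤-nonNeg (ε ℚ.* ε ℚ.* toℚ k) {{εεk≥0}} (^ℚ*≤ 0<ε εεk≤1 e s) ⟩
  toℚ s ℚ.* (ε ℚ.* ε ℚ.* toℚ k)
    ≤⟨ ℚ.*-monoˡ-≤-nonNeg (toℚ s) {{toℚ-nonNeg s}} εεk≤1 ⟩
  toℚ s ℚ.* 1ℚ
    ≡⟨ ℚ.*-identityʳ (toℚ s) ⟩
  toℚ s ∎
  where
  open ℚ.≤-Reasoning
  open +-*-Solver
  P = ε ^ℚ (e * 2)
  X = toℚ (k ^ e * s)
  instance
    ε≥0 : NonNegative ε
    ε≥0 = nonNegative (ℚ.<⇒≤ 0<ε)
    k≥0 : NonNegative (toℚ k)
    k≥0 = toℚ-nonNeg k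
    εε≥0 : NonNegative (ε ℚ.* ε)
    εε≥0 = ℚ.nonNeg*nonNeg⇒nonNeg ε ε
  εεk≥0 : NonNegative (ε ℚ.* ε ℚ.* toℚ k)
  εεk≥0 = ℚ.nonNeg*nonNeg⇒nonNeg (ε ℚ.* ε) (toℚ k)

^ℚ-bound : ∀ {ε k} → 0ℚ ℚ.< ε → ε ℚ.* ε ℚ.* toℚ k ℚ.≤ 1ℚ → ∀ e {n s} → n ≤ k ^ e * s →
  (ε ^ℚ (e * 2)) ℚ.* toℚ n ℚ.≤ toℚ s
^ℚ-bound {ε} 0<ε εεk≤1 e {n} {s} n≤ = ℚ.≤-trans
  (ℚ.*-monoˡ-≤-nonNeg (ε ^ℚ (e * 2)) {{^ℚ-nonNeg (e * 2)}} (toℚ-mono-≤ n≤)) (^ℚ*≤ 0<ε εεk≤1 e s)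
  where
  ^ℚ-nonNeg : ∀ i → NonNegative (ε ^ℚ i)
  ^ℚ-nonNeg zero    = _
  ^ℚ-nonNeg (suc i) = ℚ.nonNeg*nonNeg⇒nonNeg ε {{nonNegative (ℚ.<⇒≤ 0<ε)}} (ε ^ℚ i) {{^ℚ-nonNeg i}}

^ℚ*≤⁻¹ : ∀ {ε k} → ε ℚ.* toℚ k ≡ 1ℚ → ∀ i {n s} → (ε ^ℚ i) ℚ.* toℚ n ℚ.≤ toℚ s → n ≤ k ^ i * s
^ℚ*≤⁻¹ {ε} {k} εk≡1 zero {n} {s} le = ≤-trans
  (toℚ-cancel-≤ (ℚ.≤-trans (ℚ.≤-reflexive (sym (ℚ.*-identityˡ (toℚ n)))) le))
  (≤-reflexive (sym (+-identityʳ s)))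
^ℚ*≤⁻¹ {ε} {k} εk≡1 (suc i) {n} {s} le = ≤-trans (^ℚ*≤⁻¹ εk≡1 i (begin
  P ℚ.* toℚ n                              ≡⟨ ℚ.*-identityˡ (P ℚ.* toℚ n) ⟨
  1ℚ ℚ.* (P ℚ.* toℚ n)                     ≡⟨ cong (ℚ._* (P ℚ.* toℚ n)) εk≡1 ⟨
  ε ℚ.* toℚ k ℚ.* (P ℚ.* toℚ n)            ≡⟨ solve 4
                                                (λ e k p n → e :* k :* (p :* n) := k :* (e :* p :* n))
                                                refl ε (toℚ k) P (toℚ n) ⟩
  toℚ k ℚ.* (ε ℚ.* P ℚ.* toℚ n)            ≤⟨ ℚ.*-monoˡ-≤-nonNeg (toℚ k) {{toℚ-nonNeg k}} le ⟩
  toℚ k ℚ.* toℚ s                          ≡⟨ toℚ-* k s ⟨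
  toℚ (k * s)                            ∎))
  (≤-reflexive (exchange (k ^ i) k s))
  where
  open ℚ.≤-Reasoning
  open +-*-Solver
  P = ε ^ℚ i
  exchange : ∀ a k s → a * (k * s) ≡ k * a * s
  exchange = solve-∀

-- An integer between `1 / ε` and `1 / ε²`. For `ε = a / b` it is `k = suc (b / a)`: then
-- `b ≤ a * k ≤ a + b ≤ 2 * b`, and multiplying the upper bound by `2 * a ≤ b` gives
-- `a * a * k ≤ b * b`.
approximate-reciprocal : ∀ ε → 0ℚ ℚ.< ε → ε ℚ.< ½ → ∃ λ c →
  0 < c × 1ℚ ℚ.≤ ε ℚ.* toℚ (suc c) × ε ℚ.* ε ℚ.* toℚ (suc c) ℚ.≤ 1ℚ
approximate-reciprocal (mkℚ (pos zero)  b-1 _) 0<ε ε<½ with () ← ℚ.positive 0<ε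
approximate-reciprocal (mkℚ -[1+ _ ] b-1 _) 0<ε ε<½ with () ← ℚ.positive 0<ε
approximate-reciprocal ε@(mkℚ (+[1+ a-1 ]) b-1 _) 0<ε (*<* ε<½) =
  b / a , m≥n⇒m/n>0 a≤b ,
  ℚ.*-cancelʳ-≤-pos (toℚ b) {{toℚ-pos b-1}} (begin
    1ℚ ℚ.* toℚ b                   ≡⟨ ℚ.*-identityˡ (toℚ b) ⟩
    toℚ b                          ≤⟨ toℚ-mono-≤ b≤ak ⟩
    toℚ (a * k)                  ≡⟨ toℚ-* a k ⟩
    toℚ a ℚ.* toℚ k                ≡⟨ cong (ℚ._* toℚ k) εb≡a ⟨
    ε ℚ.* toℚ b ℚ.* toℚ k          ≡⟨ solve 3 (λ e b k → e :* b :* k := e :* k :* b)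
                                        refl ε (toℚ b) (toℚ k) ⟩
    ε ℚ.* toℚ k ℚ.* toℚ b          ∎) ,
  ℚ.*-cancelʳ-≤-pos (toℚ b ℚ.* toℚ b)
    {{ℚ.pos*pos⇒pos (toℚ b) {{toℚ-pos b-1}} (toℚ b) {{toℚ-pos b-1}}}} (begin
    ε ℚ.* ε ℚ.* toℚ k ℚ.* (toℚ b ℚ.* toℚ b)
      ≡⟨ solve 3 (λ e k b → e :* e :* k :* (b :* b) := e :* b :* (e :* b) :* k) refl ε (toℚ k) (toℚ b) ⟩
    ε ℚ.* toℚ b ℚ.* (ε ℚ.* toℚ b) ℚ.* toℚ k
      ≡⟨ cong (λ z → z ℚ.* z ℚ.* toℚ k) εb≡a ⟩
    toℚ a ℚ.* toℚ a ℚ.* toℚ k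
      ≡⟨ ≡.trans (toℚ-* (a * a) k) (cong (ℚ._* toℚ k) (toℚ-* a a)) ⟨
    toℚ (a * a * k)
      ≤⟨ toℚ-mono-≤ aak≤bb ⟩
    toℚ (b * b)
      ≡⟨ toℚ-* b b ⟩
    toℚ b ℚ.* toℚ b
      ≡⟨ ℚ.*-identityˡ _ ⟨
    1ℚ ℚ.* (toℚ b ℚ.* toℚ b) ∎)
  where
  open ℚ.≤-Reasoning
  open +-*-Solver
  a = suc a-1
  b = suc b-1
  k = suc (b / a)
  εb≡a : ε ℚ.* toℚ b ≡ toℚ a
  εb≡a = clear-denominator {ε} {a} {b-1} ℚᵘ.≃-refl
  a+a≤b : a + a ≤ b
  a+a≤b = ≤-trans (≤-reflexive (≡.trans (cong (a +_) (sym (+-identityʳ a))) (*-comm 2 a)))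
    (≤-trans (<⇒≤ (ℤ.drop‿+<+ ε<½)) (≤-reflexive (+-identityʳ b)))
  a≤b : a ≤ b
  a≤b = ≤-trans (m≤m+n a a) a+a≤b
  b≤ak : b ≤ a * k
  b≤ak = ≤-trans (≤-reflexive (m≡m%n+[m/n]*n b a))
    (≤-trans (+-monoˡ-≤ (b / a * a) (<⇒≤ (m%n<n b a))) (≤-reflexive (*-comm k a)))
  aak≤bb : a * a * k ≤ b * b
  aak≤bb = *-cancelˡ-≤ 2 (≤-trans (≤-reflexive (e₁ a (b / a)))
    (≤-trans (*-mono-≤ a+a≤b (+-mono-≤ a≤b (m/n*n≤m b a))) (≤-reflexive (e₂ b))))
    where
    e₁ : ∀ a d → 2 * (a * a * suc d) ≡ (a + a) * (a + d * a)
    e₁ = solve-∀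
    e₂ : ∀ b → b * (b + b) ≡ 2 * (b * b)
    e₂ = solve-∀

reciprocal : ∀ k → 3 ≤ k → ∃ λ ε → 0ℚ ℚ.< ε × ε ℚ.< ½ × ε ℚ.* toℚ k ≡ 1ℚ
reciprocal (suc c) 3≤k = ε ,
  ℚ.toℚᵘ-cancel-< (ℚᵘ.<-respʳ-≃ (ℚᵘ.≃-sym ε≃) (ℚᵘ.*<* (ℤ.+<+ (s≤s z≤n)))) ,
  ℚ.toℚᵘ-cancel-< (ℚᵘ.<-respˡ-≃ (ℚᵘ.≃-sym ε≃) (ℚᵘ.*<* (ℤ.+<+ (≤-trans 3≤k (m≤m+n (suc c) 0))))) ,
  clear-denominator {ε} {1} {c} ε≃
  where
  ε = fromℚᵘ (mkℚᵘ (pos 1) c)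
  ε≃ : toℚᵘ ε ≃ mkℚᵘ (pos 1) c
  ε≃ = ℚ.toℚᵘ-fromℚᵘ (mkℚᵘ (pos 1) c)

-- Homogeneity as an integer inequality, and the forward implication

edges+nonedges : ∀ {n} (G : Graph n) S →
  edgesIn G S + cliques (nonAdj G) 2 (select S id) ≡ ∣ S ∣ C 2
edges+nonedges G S = ≡.trans
  (cong (_+ cliques (nonAdj G) 2 (select S id)) (edgesIn≡cliques₂ G S))
  (≡.trans (cliques₂-not (adj G) (nonAdj G) (λ _ _ → refl) (select S id))
    (cong (_C 2) (length-select S id)))

-- Edge density at most 1/k or at least 1 - 1/k.
Extreme : ∀ {n} → Graph n → ℕ → List (Fin n) → Set
Extreme G k xs =
  k * cliques (adj G) 2 xs ≤ length xs C 2 ⊎ k * cliques (nonAdj G) 2 xs ≤ length xs C 2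

Extreme⇒Homogeneous : ∀ {n} (G : Graph n) {ε k} S → 0ℚ ℚ.< ε → 1ℚ ℚ.≤ ε ℚ.* toℚ k →
  Extreme G k (select S id) → Homogeneous G ε S
Extreme⇒Homogeneous G {ε} {k} S 0<ε 1≤εk (inj₁ le) = inj₁ (
  ≤ε* {ε} {k} 0<ε 1≤εk {edgesIn G S} {∣ S ∣ C 2}
  (subst₂ (λ e s → k * e ≤ s C 2) (sym (edgesIn≡cliques₂ G S)) (length-select S id) le))
Extreme⇒Homogeneous G {ε} {k} S 0<ε 1≤εk (inj₂ le) = inj₂ (
  [1-ε]*≤ {ε} {edgesIn G S} {cliques (nonAdj G) 2 (select S id)} (edges+nonedges G S)
    (≤ε* {ε} {k} 0<ε 1≤εk (subst (λ s → k * cliques (nonAdj G) 2 (select S id) ≤ s C 2)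
      (length-select S id) le)))

Homogeneous⇒Extreme : ∀ {n} (G : Graph n) {ε k} S → ε ℚ.* toℚ k ≡ 1ℚ →
  Homogeneous G ε S → Extreme G k (select S id)
Homogeneous⇒Extreme G {ε} {k} S εk≡1 (inj₁ le) = inj₁
  (subst₂ (λ e s → k * e ≤ s C 2) (edgesIn≡cliques₂ G S) (sym (length-select S id))
    (≤ε*⁻¹ {ε} {k} εk≡1 {edgesIn G S} {∣ S ∣ C 2} le))
Homogeneous⇒Extreme G {ε} {k} S εk≡1 (inj₂ le) = inj₂
  (subst (λ s → k * cliques (nonAdj G) 2 (select S id) ≤ s C 2) (sym (length-select S id))
    (≤ε*⁻¹ {ε} {k} εk≡1 {cliques (nonAdj G) 2 (select S id)} {∣ S ∣ C 2}
      ([1-ε]*≤⁻¹ {ε} {edgesIn G S} {cliques (nonAdj G) 2 (select S id)} (edges+nonedges G S) le)))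

-- Up to `k ^ e` vertices a single vertex is large enough, and it is extreme because it spans no
-- pair. Beyond that, the existence of the set is decidable by search over all subsets, so refuting
-- its absence produces it.
large-extreme-set : (F : Family) → Hereditary F → ∀ p q → 0 < p → 0 < q →
  (∀ n (G : Graph n) → F n G → n ^ p ≤ hom G ^ q) →
  ∀ c → 0 < c → ∀ n (G : Graph n) → F n G → let k = suc c; e = 2 * suc ((2 + 52 * q) * q) in
  ∃ λ S → Extreme G k (select S id) × n ≤ k ^ e * length (select S id)
large-extreme-set F hereditary p q 0<p 0<q eh c 0<c n G G∈F
  with n ≤? suc c ^ (2 * suc ((2 + 52 * q) * q))
large-extreme-set F hereditary p q 0<p 0<q eh c 0<c zero G G∈F | yes n≤ =
  [] , inj₁ (≤-reflexive (*-zeroʳ c)) , z≤n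
large-extreme-set F hereditary p q 0<p 0<q eh c 0<c (suc n) G G∈F | yes n≤
  with ⊆⇒select id {zero ∷ []} (refl ∷ minimum _)
... | S , eq = S , subst (Extreme G (suc c)) (sym eq) (inj₁ (≤-reflexive (*-zeroʳ c))) ,
  subst (λ xs → suc n ≤ suc c ^ (2 * suc ((2 + 52 * q) * q)) * length xs) (sym eq)
    (≤-trans n≤ (≤-reflexive (sym (*-identityʳ _))))
large-extreme-set F hereditary p q 0<p 0<q eh c 0<c n G G∈F | no n≰ with anySubset? (λ S →
    ((suc c * cliques (adj G) 2 (select S id) ≤? length (select S id) C 2) ⊎-dec
     (suc c * cliques (nonAdj G) 2 (select S id) ≤? length (select S id) C 2)) ×-dec
    (n ≤? suc c ^ (2 * suc ((2 + 52 * q) * q)) * length (select S id)))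
... | yes found = found
... | no none = contradiction
  (λ xs xs⊆ n≤ →
    ≰⇒> (λ le → absurd xs xs⊆ n≤ (inj₁ le)) , ≰⇒> (λ le → absurd xs xs⊆ n≤ (inj₂ le)))
  (not-everywhere-dense (adj G) (nonAdj G) (Graph.sym G) (nonAdj-sym G) (λ _ _ → refl)
    c q r (allFin n) 0<c (exponent-choice (suc c) q (s≤s 0<c) 0<q)
    (≤-trans (≰⇒> n≰) (≤-reflexive (sym n≡)))
    (ErdosHajnal⇒cliques>0 F hereditary p q 0<p 0<q eh G G∈F (suc c ^ r) {{m^n≢0 (suc c) r}}))
  where
  r = 2 + 52 * q
  n≡ : length (allFin n) ≡ n
  n≡ = length-tabulate id
  absurd : ∀ xs → xs ⊆ allFin n → length (allFin n) ≤ suc c ^ (2 * suc (r * q)) * length xs →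
    Extreme G (suc c) xs → ⊥
  absurd xs xs⊆ n≤ extreme with ⊆⇒select id xs⊆
  ... | S , refl = none (S , extreme , ≤-trans (≤-reflexive (sym n≡)) n≤)

extreme⇒PolyRodl : (F : Family) (e : ℕ) →
  (∀ c → 0 < c → ∀ n (G : Graph n) → F n G →
    ∃ λ S → Extreme G (suc c) (select S id) × n ≤ suc c ^ e * length (select S id)) →
  PolyRodl F
extreme⇒PolyRodl F e extreme-set = e * 2 , λ ε 0<ε ε<½ n G G∈F →
  let c , 0<c , 1≤εk , εεk≤1 = approximate-reciprocal ε 0<ε ε<½
      S , extreme , n≤ = extreme-set c 0<c n G G∈F
  in S , Extreme⇒Homogeneous G {ε} {suc c} S 0<ε 1≤εk extreme ,
    ^ℚ-bound {ε} {suc c} 0<ε εεk≤1 e {n} {∣ S ∣}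
      (subst (λ s → n ≤ suc c ^ e * s) (length-select S id) n≤)

ErdosHajnal⇒PolyRodl : (F : Family) → Hereditary F → ErdosHajnal F → PolyRodl F
ErdosHajnal⇒PolyRodl F hereditary (p , q , 0<p , 0<q , eh) = extreme⇒PolyRodl F
  (2 * suc ((2 + 52 * q) * q)) (large-extreme-set F hereditary p q 0<p 0<q eh)

-- The converse implication

sparse⇒no-edges : {A : Set} (R : BoolRel A) → ∀ r xs → r ≤ length xs → 0 < length xs →
  r * r * cliques R 2 xs ≤ length xs C 2 →
  ∃ λ ys → (ys ⊆ xs) × (length ys ≡ r) × cliques R 2 ys ≡ 0
sparse⇒no-edges R r xs r≤ 0<s sparse
  -- From `s` vertices with at most `(s C 2) / r²` related pairs, thinning to `r` vertices leaves at
  -- most `(s C 2) / s²` of them, which is less than one.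
  with sparsify {t = 2} {cliques R 2} (cliques-counts R 2) r xs r≤
... | ys , s , ℓ , le = ys , s , ℓ , n<1⇒n≡0 (*-cancelʳ-< (length xs ^ 2) _ 1 (begin-strict
  cliques R 2 ys * length xs ^ 2       ≤⟨ le ⟩
  cliques R 2 xs * r ^ 2               ≡⟨ regroup (cliques R 2 xs) r ⟩
  r * r * cliques R 2 xs               ≤⟨ sparse ⟩
  length xs C 2                        <⟨ C₂<^2 (length xs) 0<s ⟩
  length xs ^ 2                        ≡⟨ *-identityˡ _ ⟨
  1 * length xs ^ 2                    ∎))
  where
  open ≤-Reasoning
  regroup : ∀ h r → h * (r * (r * 1)) ≡ r * r * h
  regroup = solve-∀
  C₂<^2 : ∀ s → 0 < s → s C 2 < s ^ 2
  C₂<^2 (suc b) _ = begin-strict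
    suc b C 2           ≤⟨ m≤m+n _ _ ⟩
    2 * (suc b C 2)     ≡⟨ 2*C₂ b ⟩
    suc b * b           <⟨ *-monoʳ-< (suc b) (≤-reflexive (sym (*-identityʳ (suc b)))) ⟩
    suc b ^ 2           ∎

Extreme⇒≤hom : ∀ {n} (G : Graph n) r S → r ≤ ∣ S ∣ → 0 < ∣ S ∣ →
  Extreme G (r * r) (select S id) → r ≤ hom G
Extreme⇒≤hom G r S r≤ 0<s extreme = go extreme
  where
  r≤ℓ = ≤-trans r≤ (≤-reflexive (sym (length-select S id)))
  0<ℓ = ≤-trans 0<s (≤-reflexive (sym (length-select S id)))
  go : Extreme G (r * r) (select S id) → r ≤ hom G
  go (inj₁ le) with sparse⇒no-edges (adj G) r (select S id) r≤ℓ 0<ℓ le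
  ... | ys , s , refl , eq = no-edges⇒length≤hom G (⊆-trans s (select-⊆ S id)) eq
  go (inj₂ le) with sparse⇒no-edges (nonAdj G) r (select S id) r≤ℓ 0<ℓ le
  ... | ys , s , refl , eq = no-nonedges⇒length≤hom G (⊆-trans s (select-⊆ S id)) eq

hom≥1 : ∀ {n} (G : Graph (suc n)) → 1 ≤ hom G
hom≥1 G = no-edges⇒length≤hom G {zero ∷ []} (refl ∷ minimum _) refl

hom≥2 : ∀ {n} (G : Graph (2 + n)) → 2 ≤ hom G
hom≥2 {n} G = by-adjacency (adj G zero (suc zero)) refl
  where
  first-two : zero ∷ suc zero ∷ [] ⊆ allFin (2 + n)
  first-two = refl ∷ refl ∷ minimum _
  by-adjacency : ∀ b → adj G zero (suc zero) ≡ b → 2 ≤ hom G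
  by-adjacency true eq = no-nonedges⇒length≤hom G first-two no-nonedge
    where
    no-nonedge : cliques (nonAdj G) 2 (zero ∷ suc zero ∷ []) ≡ 0
    no-nonedge rewrite eq = refl
  by-adjacency false eq = no-edges⇒length≤hom G first-two no-edge
    where
    no-edge : cliques (adj G) 2 (zero ∷ suc zero ∷ []) ≡ 0
    no-edge rewrite eq = refl

integer-root : ∀ e n → ∃ λ r → 1 ≤ r × r ^ suc e ≤ suc n × suc n < suc r ^ suc e
integer-root e zero = 1 , ≤-refl , ≤-reflexive (^-zeroˡ (suc e)) , *-monoʳ-≤ 2 (m^n>0 2 e)
integer-root e (suc n) with integer-root e n
... | r , 1≤r , lo , hi with m≤n⇒m<n∨m≡n hi
...   | inj₁ hi′ = r , 1≤r , m≤n⇒m≤1+n lo , hi′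
...   | inj₂ eq  = suc r , s≤s z≤n , ≤-reflexive (sym eq) ,
        ≤-trans (s≤s (≤-reflexive eq)) (^-monoˡ-< (suc e) ≤-refl)

-- With `ε = 1 / r²` the size guarantee reads `n ≤ r ^ (2 * K) * s`, so one further factor `r` in
-- `n` is what forces `s ≥ r`.
Homogeneous⇒≤hom : ∀ {n} (G : Graph n) {ε} r K S → 2 ≤ r → r ^ suc (2 * K) ≤ n →
  ε ℚ.* toℚ (r * r) ≡ 1ℚ → Homogeneous G ε S → (ε ^ℚ K) ℚ.* toℚ n ℚ.≤ toℚ ∣ S ∣ → r ≤ hom G
Homogeneous⇒≤hom {n} G {ε} r K S 2≤r r^≤n εk≡1 homogeneous large =
  Extreme⇒≤hom G r S r≤s (≤-trans (s≤s z≤n) (≤-trans 2≤r r≤s))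
    (Homogeneous⇒Extreme G {ε} {r * r} S εk≡1 homogeneous)
  where
  open ≤-Reasoning
  s = ∣ S ∣
  r≤s : r ≤ s
  r≤s = *-cancelʳ-≤ r s (r ^ (2 * K)) {{m^n≢0 r (2 * K) {{>-nonZero (≤-trans (s≤s z≤n) 2≤r)}}}} (begin
    r ^ suc (2 * K)        ≤⟨ r^≤n ⟩
    n                      ≤⟨ ^ℚ*≤⁻¹ {ε} {r * r} εk≡1 K {n} {s} large ⟩
    (r * r) ^ K * s        ≡⟨ cong (λ z → (r * z) ^ K * s) (sym (*-identityʳ r)) ⟩
    (r ^ 2) ^ K * s        ≡⟨ cong (_* s) (^-*-assoc r 2 K) ⟩
    r ^ (2 * K) * s        ≡⟨ *-comm _ s ⟩
    s * r ^ (2 * K)        ∎)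

PolyRodl⇒ErdosHajnal : (F : Family) → PolyRodl F → ErdosHajnal F
-- The integer root `r` only satisfies `n < suc r ^ e`; doubling the exponent absorbs the rounding,
-- as `suc r ≤ r ^ 2` for `r ≥ 2`.
PolyRodl⇒ErdosHajnal F (K , rodl) = 1 , 2 * e , ≤-refl , s≤s z≤n , bound
  where
  open ≤-Reasoning
  e = suc (2 * K)
  root≤hom : ∀ r n (G : Graph n) → F n G → 2 ≤ r → r ^ e ≤ n → r ≤ hom G
  root≤hom r n G G∈F 2≤r r^≤n =
    let ε , 0<ε , ε<½ , εk≡1 = reciprocal (r * r) (≤-trans (n≤1+n 3) (*-mono-≤ 2≤r 2≤r))
        S , homogeneous , large = rodl ε 0<ε ε<½ n G G∈F
    in Homogeneous⇒≤hom G {ε} r K S 2≤r r^≤n εk≡1 homogeneous large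
  from-root : ∀ {r} m n → 2 ≤ r → n < suc r ^ e → r ≤ m → n ^ 1 ≤ m ^ (2 * e)
  from-root {r} m n 2≤r n< r≤m = begin
    n ^ 1           ≡⟨ ^-identityʳ n ⟩
    n               ≤⟨ <⇒≤ n< ⟩
    suc r ^ e       ≤⟨ ^-monoˡ-≤ e 1+r≤r² ⟩
    (r ^ 2) ^ e     ≡⟨ ^-*-assoc r 2 e ⟩
    r ^ (2 * e)     ≤⟨ ^-monoˡ-≤ (2 * e) r≤m ⟩
    m ^ (2 * e)     ∎
    where
    1+r≤r² : suc r ≤ r ^ 2
    1+r≤r² = begin
      suc r         ≤⟨ +-monoˡ-≤ r (≤-trans (s≤s z≤n) 2≤r) ⟩
      r + r         ≡⟨ cong (r +_) (+-identityʳ r) ⟨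
      2 * r         ≤⟨ *-monoˡ-≤ r 2≤r ⟩
      r * r         ≡⟨ cong (r *_) (*-identityʳ r) ⟨
      r ^ 2         ∎
  bound : ∀ n (G : Graph n) → F n G → n ^ 1 ≤ hom G ^ (2 * e)
  bound zero G G∈F = z≤n
  bound (suc zero) G G∈F = m^n>0 (hom G) {{>-nonZero (hom≥1 G)}} (2 * e)
  bound n@(suc (suc n-2)) G G∈F with integer-root (2 * K) (suc n-2)
  -- Here `n < 2 ^ e`, and the root `1` is too small for the Rödl property to be applied. Any two
  -- vertices give `hom G ≥ 2`, so `2` takes the place of the root.
  ... | suc zero , _ , _ , hi =
    from-root {2} (hom G) n ≤-refl (<-trans hi (^-monoˡ-< e ≤-refl)) (hom≥2 G)
  ... | r@(suc (suc _)) , _ , lo , hi =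
    from-root (hom G) n (s≤s (s≤s z≤n)) hi (root≤hom r n G G∈F (s≤s (s≤s z≤n)) lo)

theorem1p7 : (F : Family) → Hereditary F →
    (ErdosHajnal F → PolyRodl F) × (PolyRodl F → ErdosHajnal F)
theorem1p7 F hereditary = ErdosHajnal⇒PolyRodl F hereditary , PolyRodl⇒ErdosHajnal F
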